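{- Let $G$ be a partial 2-tree which is a spanning subgraph of a 2-tree $G_T$. Then the complement $\overline{G}$ has a segment representation that is compatible with $G_T$.
   Context: All graphs are finite, simple and undirected. The complement $\overline{G}$ of $G$ has vertex set $V(G)$ and edge set $\{uv : u\neq v,\ uv\notin E(G)\}$. A 2-tree is defined recursively: a single edge is a 2-tree; if $H$ is a 2-tree and $xy\in E(H)$, then the graph obtained from $H$ by adding a new vertex $v$ and the edges $vx,vy$ is a 2-tree. A partial 2-tree is any spanning subgraph of a 2-tree. For points $a\neq b$ in $\mathbb{R}^2$, the segment $ab$ is $\{a+\rho(b-a):\rho\in[0,1]\}$; its end-points are $a$ and $b$, and every other point of it is an interior point. Segments are required to have non-zero length. The ray starting at $a$ and passing through $b$ is $\{a+\rho(b-a):\rho\in[0,\infty)\}$; its only end-point is $a$. Two objects $l_1,l_2$, each a segment or a ray, cross if $l_1\cap l_2$ consists of exactly one point and this point is an end-point of neither $l_1$ nor $l_2$. A segment representation of a graph $H$ is an assignment of a segment $s_u$ to each vertex $u\in V(H)$ such that for all $u\neq v$, $s_u\cap s_v\neq\emptyset$ if and only if $uv\in E(H)$. Let $G$ be a partial 2-tree, $G_T$ a 2-tree of which $G$ is a spanning subgraph, and $\mathcal{R}=\{s_u : u\in V(G)\}$ a segment representation of $\overline{G}$. Then $\mathcal{R}$ is compatible with $G_T$ if for each edge $uv\in E(G_T)$ one can choose a ray $r_{uv}$ in the plane such that: (1) $r_{uv}$ starts at an interior point of one of $s_u,s_v$, passes through an end-point of the other, and meets no other points of $s_u$ or $s_v$;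 (2) $r_{uv}$ crosses every segment $s_w$ with $w\notin\{u,v\}$; and (3) $r_{uv}$ crosses every ray $r_{xy}$ with $xy\in E(G_T)\setminus\{uv\}$. -}

module Defs where

open import Data.Nat using (ℕ)
open import Data.Fin using (Fin)
open import Data.Product using (Σ; ∃; _×_; _,_)
open import Data.Sum using (_⊎_)
open import Data.List using (List; []; _∷_)
open import Data.List.Membership.Propositional using (_∈_; _∉_)
open import Relation.Nullary using (¬_)
open import Relation.Binary.PropositionalEquality using (_≡_; _≢_)
open import Algebra.Structures using (IsCommutativeRing)
open import Relation.Binary.Structures using (IsStrictTotalOrder)

record RealField : Set₁ where
  infixl 6 _+_
  infixl 7 _*_
  infix 4 _<_ _≤_
  field
    Carrier : Set
    _+_ _*_ : Carrier → Carrier → Carrier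
    -_      : Carrier → Carrier
    0# 1#   : Carrier
    _⁻¹     : Carrier → Carrier
    _<_     : Carrier → Carrier → Set
    isCommutativeRing : IsCommutativeRing _≡_ _+_ _*_ -_ 0# 1#
    0≢1     : 0# ≢ 1#
    ⁻¹-inverse : ∀ x → x ≢ 0# → x * (x ⁻¹) ≡ 1#
    isStrictTotalOrder : IsStrictTotalOrder _≡_ _<_
    +-mono-<  : ∀ {x y} z → x < y → x + z < y + z
    *-pos     : ∀ {x y} → 0# < x → 0# < y → 0# < x * y

  _≤_ : Carrier → Carrier → Set
  x ≤ y = x < y ⊎ x ≡ y

  field
    complete : (P : Carrier → Set) → ∃ P → (∃ λ b → ∀ x → P x → x ≤ b) →
               ∃ λ s → (∀ x → P x → x ≤ s) × (∀ b → (∀ x → P x → x ≤ b) → s ≤ b)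

record Graph (n : ℕ) : Set₁ where
  field
    E     : Fin n → Fin n → Set
    sym   : ∀ {u v} → E u v → E v u
    irrefl : ∀ {u} → ¬ E u u
open Graph public

complement : ∀ {n} → Graph n → Graph n
complement G = record
  { E = λ u v → u ≢ v × ¬ E G u v
  ; sym = λ { (u≢v , ¬e) → (λ eq → u≢v (symm eq)) , (λ e → ¬e (Graph.sym G e)) }
  ; irrefl = λ { (u≢u , _) → u≢u reflex } }
  where
  open import Relation.Binary.PropositionalEquality using () renaming (sym to symm; refl to reflex)

SpanningSubgraph : ∀ {n} → Graph n → Graph n → Set
SpanningSubgraph G H = ∀ u v → E G u v → E H u v

Adj : ∀ {n} → List (Fin n × Fin n) → Fin n → Fin n → Set
Adj es u v = (u , v) ∈ es ⊎ (v , u) ∈ es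

-- recursive construction of a 2-tree: list of vertices used so far and
-- list of edges created so far
data Builds {n : ℕ} : List (Fin n) → List (Fin n × Fin n) → Set where
  base : ∀ {x y} → x ≢ y → Builds (x ∷ y ∷ []) ((x , y) ∷ [])
  step : ∀ {vs es x y v} → Builds vs es → Adj es x y → v ∉ vs →
         Builds (v ∷ vs) ((v , x) ∷ (v , y) ∷ es)

IsTwoTree : ∀ {n} → Graph n → Set
IsTwoTree {n} H = Σ (List (Fin n)) λ vs → Σ (List (Fin n × Fin n)) λ es →
  Builds vs es × (∀ u → u ∈ vs) ×
  (∀ u v → (E H u v → Adj es u v) × (Adj es u v → E H u v))

IsPartialTwoTree : ∀ {n} → Graph n → Set₁
IsPartialTwoTree G = Σ (Graph _) λ H → IsTwoTree H × SpanningSubgraph G H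

module Geometry (R : RealField) where
  open RealField R

  Point : Set
  Point = Carrier × Carrier

  _⊕_ : Point → Point → Point
  (a₁ , a₂) ⊕ (b₁ , b₂) = (a₁ + b₁ , a₂ + b₂)

  _⊖_ : Point → Point → Point
  (a₁ , a₂) ⊖ (b₁ , b₂) = (a₁ + - b₁ , a₂ + - b₂)

  _·_ : Carrier → Point → Point
  ρ · (b₁ , b₂) = (ρ * b₁ , ρ * b₂)

  record Segment : Set where
    constructor seg
    field
      a b  : Point
      a≢b  : a ≢ b

  record Ray : Set where
    constructor ray
    field
      start through : Point
      start≢through : start ≢ through

  _∈S_ : Point → Segment → Set
  p ∈S seg a b _ = ∃ λ ρ → 0# ≤ ρ × ρ ≤ 1# × p ≡ a ⊕ (ρ · (b ⊖ a))

  EndS : Point → Segment → Set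
  EndS p (seg a b _) = p ≡ a ⊎ p ≡ b

  InteriorS : Point → Segment → Set
  InteriorS p s = p ∈S s × ¬ EndS p s

  _∈R_ : Point → Ray → Set
  p ∈R ray a b _ = ∃ λ ρ → 0# ≤ ρ × p ≡ a ⊕ (ρ · (b ⊖ a))

  EndR : Point → Ray → Set
  EndR p r = p ≡ Ray.start r

  Cross : (Point → Set) → (Point → Set) → (Point → Set) → (Point → Set) → Set
  Cross M₁ End₁ M₂ End₂ = ∃ λ p → M₁ p × M₂ p × (∀ q → M₁ q → M₂ q → q ≡ p) ×
                                   ¬ End₁ p × ¬ End₂ p

  CrossRS : Ray → Segment → Set
  CrossRS r s = Cross (_∈R r) (λ p → EndR p r) (_∈S s) (λ p → EndS p s)

  CrossRR : Ray → Ray → Set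
  CrossRR r r' = Cross (_∈R r) (λ p → EndR p r) (_∈R r') (λ p → EndR p r')

  SegmentRep : ∀ {n} → Graph n → (Fin n → Segment) → Set
  SegmentRep H s = ∀ u v → u ≢ v →
    ((∃ λ p → p ∈S s u × p ∈S s v) → E H u v) × (E H u v → ∃ λ p → p ∈S s u × p ∈S s v)

  StartsIn : Ray → Segment → Segment → Set
  StartsIn r su sv = InteriorS (Ray.start r) su ×
    ∃ λ e → EndS e sv × e ∈R r ×
      (∀ p → p ∈R r → (p ∈S su ⊎ p ∈S sv) → p ≡ Ray.start r ⊎ p ≡ e)

  -- the segment representation s is compatible with the 2-tree GT;
  -- rays are chosen for every ordered pair, but constraints apply only to edges
  Compatible : ∀ {n} → Graph n → (Fin n → Segment) → Set
  Compatible {n} GT s = Σ (Fin n → Fin n → Ray) λ r →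
    ∀ u v → E GT u v →
      (StartsIn (r u v) (s u) (s v) ⊎ StartsIn (r u v) (s v) (s u)) ×
      (∀ w → w ≢ u → w ≢ v → CrossRS (r u v) (s w)) ×
      (∀ x y → E GT x y → ¬ (x ≡ u × y ≡ v) → ¬ (x ≡ v × y ≡ u) → CrossRR (r u v) (r x y))

{-# OPTIONS --safe #-}

-- The proof adds the vertices of the 2-tree one at a time.  Let v be attached to the edge xy, and let the ray
-- r_xy start inside s_x and pass through the tip e of s_y; call r_xy the axis.  Everything else crosses the
-- axis transversally, so it also crosses every line that is close enough to the axis.  Choose s_v on such a
-- line, from a point near the start of r_xy to a point B beyond all crossings: it crosses everything except
-- possibly s_x and s_y, meets s_x or not depending on which side of s_x it begins, and meets s_y or not
-- depending on which side of e it passes.  The ray r_vx runs from s_x through B.  The ray r_vy runs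
-- *backwards*: it starts on s_v beyond all crossings, passes through e and then crosses s_x.
--
-- Crossings are recorded in the form "the two carrier lines have exactly one common point, and its parameters
-- lie strictly inside the domains", which is what survives small perturbations.  Edges of G need not be
-- decidable, but completeness of the field decides negated statements, and that is enough to choose
-- the side on which s_v begins and passes.

module Submission where

open import Defs hiding (sym)
open import Algebra.Bundles using (CommutativeRing)
import Algebra.Properties.Ring as RingProperties
import Algebra.Solver.Ring as RingSolver
open import Algebra.Solver.Ring.AlmostCommutativeRing using (fromCommutativeRing; _-Raw-AlmostCommutative⟶_)
open import Data.Bool.Base using (Bool; true; false)
open import Data.Empty using (⊥; ⊥-elim)
open import Data.Fin using (Fin)
open import Data.Fin.Properties using (_≟_)
open import Data.Integer.Base as ℤ using (ℤ; -[1+_])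
import Data.Integer.Properties as ℤₚ
open import Data.List.Base using (List; []; _∷_; _++_; map; filter)
open import Data.List.Membership.Propositional using (_∈_; _∉_; find; lose)
open import Data.List.Membership.Propositional.Properties using (∈-map⁺; ∈-map⁻; ∈-++⁺ˡ; ∈-++⁺ʳ; ∈-filter⁺; ∈-filter⁻)
open import Data.List.Relation.Unary.All as All using (All; []; _∷_)
import Data.List.Relation.Unary.All.Properties as Allₚ
open import Data.List.Relation.Unary.AllPairs using (AllPairs; []; _∷_)
open import Data.List.Relation.Unary.Any using (here; there; any?)
open import Data.Maybe.Base using (Maybe; just; nothing)
open import Data.Nat as ℕ using (ℕ; zero; suc)
open import Data.Product using (Σ; ∃; _×_; _,_; proj₁; proj₂)
open import Data.Sum as Sum using (_⊎_; inj₁; inj₂)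
open import Relation.Binary.Definitions using (Tri; tri<; tri≈; tri>)
open import Relation.Binary.PropositionalEquality using (_≡_; _≢_; refl; sym; trans; cong; cong₂; subst; subst₂; module ≡-Reasoning)
open import Relation.Binary.Structures using (IsStrictTotalOrder)
open import Relation.Nullary using (¬_; Dec; yes; no; ¬?; _×-dec_; _⊎-dec_)

-- Ordered fields

module OrderedField (R : RealField) where
  open RealField R

  commutativeRing : CommutativeRing _ _
  commutativeRing = record { isCommutativeRing = isCommutativeRing }

  open CommutativeRing commutativeRing public
    using (+-comm; +-assoc; -‿inverseʳ; +-identityˡ; +-identityʳ; *-comm; *-assoc; *-identityˡ; *-identityʳ; zeroˡ; zeroʳ; distribʳ)
  open RingProperties (CommutativeRing.ring commutativeRing) public
    using (-‿distribˡ-*; -‿distribʳ-*; -0#≈0#; -‿involutive; -‿anti-homo-+)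

  open IsStrictTotalOrder isStrictTotalOrder public using (compare) renaming (trans to <-trans; irrefl to <-irrefl; asym to <-asym)

  -- Integers as coefficients of the ring solver.

  fromℕ : ℕ → Carrier
  fromℕ zero          = 0#
  -- A separate clause, since `1# + 0#` does not compute to `1#`. Now `1-homo` is `refl`, and the
  -- constant `:1` stands for `1#` itself.
  fromℕ (suc zero)    = 1#
  fromℕ (suc (suc n)) = 1# + fromℕ (suc n)

  fromℤ : ℤ → Carrier
  fromℤ (ℤ.+ n)      = fromℕ n
  fromℤ (-[1+ n ]) = - fromℕ (suc n)

  fromℕ-suc : ∀ n → fromℕ (suc n) ≡ 1# + fromℕ n
  fromℕ-suc zero    = sym (+-identityʳ 1#)
  fromℕ-suc (suc n) = refl

  fromℕ-+ : ∀ m n → fromℕ (m ℕ.+ n) ≡ fromℕ m + fromℕ n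
  fromℕ-+ zero    n = sym (+-identityˡ _)
  fromℕ-+ (suc m) n = begin
    fromℕ (suc (m ℕ.+ n))      ≡⟨ fromℕ-suc (m ℕ.+ n) ⟩
    1# + fromℕ (m ℕ.+ n)       ≡⟨ cong (_+_ 1#) (fromℕ-+ m n) ⟩
    1# + (fromℕ m + fromℕ n)   ≡⟨ sym (+-assoc _ _ _) ⟩
    1# + fromℕ m + fromℕ n     ≡⟨ cong (_+ fromℕ n) (sym (fromℕ-suc m)) ⟩
    fromℕ (suc m) + fromℕ n    ∎
    where open ≡-Reasoning

  fromℕ-* : ∀ m n → fromℕ (m ℕ.* n) ≡ fromℕ m * fromℕ n
  fromℕ-* zero    n = sym (zeroˡ _)
  fromℕ-* (suc m) n = begin
    fromℕ (n ℕ.+ m ℕ.* n)              ≡⟨ fromℕ-+ n (m ℕ.* n) ⟩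
    fromℕ n + fromℕ (m ℕ.* n)          ≡⟨ cong₂ _+_ (sym (*-identityˡ _)) (fromℕ-* m n) ⟩
    1# * fromℕ n + fromℕ m * fromℕ n   ≡⟨ sym (distribʳ _ _ _) ⟩
    (1# + fromℕ m) * fromℕ n           ≡⟨ cong (_* fromℕ n) (sym (fromℕ-suc m)) ⟩
    fromℕ (suc m) * fromℕ n            ∎
    where open ≡-Reasoning

  fromℤ-neg : ∀ i → fromℤ (ℤ.- i) ≡ - fromℤ i
  fromℤ-neg (ℤ.+ zero)   = sym -0#≈0#
  fromℤ-neg (ℤ.+ suc n)  = refl
  fromℤ-neg (-[1+ n ]) = sym (-‿involutive _)

  fromℤ-⊖ : ∀ m n → fromℤ (m ℤ.⊖ n) ≡ fromℕ m + - fromℕ n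
  fromℤ-⊖ zero    zero    = sym (-‿inverseʳ _)
  fromℤ-⊖ zero    (suc n) = sym (+-identityˡ _)
  fromℤ-⊖ (suc m) zero    = sym (trans (cong (_+_ (fromℕ (suc m))) -0#≈0#) (+-identityʳ _))
  fromℤ-⊖ (suc m) (suc n) = begin
    fromℤ (suc m ℤ.⊖ suc n)                       ≡⟨ cong fromℤ (ℤₚ.[1+m]⊖[1+n]≡m⊖n m n) ⟩
    fromℤ (m ℤ.⊖ n)                               ≡⟨ fromℤ-⊖ m n ⟩
    fromℕ m + - fromℕ n                           ≡⟨ cong (_+ - fromℕ n) (sym (+-identityʳ _)) ⟩
    fromℕ m + 0# + - fromℕ n                      ≡⟨ cong (λ z → fromℕ m + z + - fromℕ n) (sym (-‿inverseʳ 1#)) ⟩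
    fromℕ m + (1# + - 1#) + - fromℕ n             ≡⟨ cong (_+ - fromℕ n) (sym (+-assoc _ _ _)) ⟩
    fromℕ m + 1# + - 1# + - fromℕ n               ≡⟨ +-assoc _ _ _ ⟩
    fromℕ m + 1# + (- 1# + - fromℕ n)             ≡⟨ cong₂ _+_ (+-comm _ _) (trans (+-comm _ _) (sym (-‿anti-homo-+ _ _))) ⟩
    1# + fromℕ m + - (1# + fromℕ n)               ≡⟨ cong₂ (λ a b → a + - b) (sym (fromℕ-suc m)) (sym (fromℕ-suc n)) ⟩
    fromℕ (suc m) + - fromℕ (suc n)               ∎
    where open ≡-Reasoning

  fromℤ-+ : ∀ i j → fromℤ (i ℤ.+ j) ≡ fromℤ i + fromℤ j
  fromℤ-+ (ℤ.+ m)      (ℤ.+ n)      = fromℕ-+ m n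
  fromℤ-+ (ℤ.+ m)      (-[1+ n ]) = fromℤ-⊖ m (suc n)
  fromℤ-+ (-[1+ m ]) (ℤ.+ n)      = trans (fromℤ-⊖ n (suc m)) (+-comm _ _)
  fromℤ-+ (-[1+ m ]) (-[1+ n ]) = begin
    - (1# + fromℕ (suc (m ℕ.+ n)))            ≡⟨ cong (λ z → - (1# + z)) (fromℕ-+ (suc m) n) ⟩
    - (1# + (fromℕ (suc m) + fromℕ n))        ≡⟨ cong -_ (sym (+-assoc _ _ _)) ⟩
    - (1# + fromℕ (suc m) + fromℕ n)          ≡⟨ cong (λ z → - (z + fromℕ n)) (+-comm _ _) ⟩
    - (fromℕ (suc m) + 1# + fromℕ n)          ≡⟨ cong -_ (+-assoc _ _ _) ⟩
    - (fromℕ (suc m) + (1# + fromℕ n))        ≡⟨ cong (λ z → - (fromℕ (suc m) + z)) (sym (fromℕ-suc n)) ⟩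
    - (fromℕ (suc m) + fromℕ (suc n))         ≡⟨ -‿anti-homo-+ _ _ ⟩
    - fromℕ (suc n) + - fromℕ (suc m)         ≡⟨ +-comm _ _ ⟩
    - fromℕ (suc m) + - fromℕ (suc n)         ∎
    where open ≡-Reasoning

  fromℤ-+* : ∀ m j → fromℤ (ℤ.+ m ℤ.* j) ≡ fromℕ m * fromℤ j
  fromℤ-+* m (ℤ.+ n)      = trans (cong fromℤ (sym (ℤₚ.pos-* m n))) (fromℕ-* m n)
  fromℤ-+* m (-[1+ n ]) = begin
    fromℤ (ℤ.+ m ℤ.* ℤ.- (ℤ.+ suc n))       ≡⟨ cong fromℤ (sym (ℤₚ.neg-distribʳ-* (ℤ.+ m) (ℤ.+ suc n))) ⟩
    fromℤ (ℤ.- (ℤ.+ m ℤ.* ℤ.+ suc n))       ≡⟨ fromℤ-neg (ℤ.+ m ℤ.* ℤ.+ suc n) ⟩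
    - fromℤ (ℤ.+ m ℤ.* ℤ.+ suc n)           ≡⟨ cong -_ (fromℤ-+* m (ℤ.+ suc n)) ⟩
    - (fromℕ m * fromℕ (suc n))         ≡⟨ -‿distribʳ-* _ _ ⟩
    fromℕ m * - fromℕ (suc n)           ∎
    where open ≡-Reasoning

  fromℤ-* : ∀ i j → fromℤ (i ℤ.* j) ≡ fromℤ i * fromℤ j
  fromℤ-* (ℤ.+ m)      j = fromℤ-+* m j
  fromℤ-* (-[1+ m ]) j = begin
    fromℤ (ℤ.- (ℤ.+ suc m) ℤ.* j)     ≡⟨ cong fromℤ (sym (ℤₚ.neg-distribˡ-* (ℤ.+ suc m) j)) ⟩
    fromℤ (ℤ.- (ℤ.+ suc m ℤ.* j))     ≡⟨ fromℤ-neg (ℤ.+ suc m ℤ.* j) ⟩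
    - fromℤ (ℤ.+ suc m ℤ.* j)         ≡⟨ cong -_ (fromℤ-+* (suc m) j) ⟩
    - (fromℕ (suc m) * fromℤ j)     ≡⟨ -‿distribˡ-* _ _ ⟩
    - fromℕ (suc m) * fromℤ j       ∎
    where open ≡-Reasoning

  ℤ-morphism : ℤ.+-*-rawRing -Raw-AlmostCommutative⟶ fromCommutativeRing commutativeRing
  ℤ-morphism = record
    { ⟦_⟧ = fromℤ ; +-homo = fromℤ-+ ; *-homo = fromℤ-* ; -‿homo = fromℤ-neg ; 0-homo = refl ; 1-homo = refl }

  ℤ-coefficient≟ : ∀ i j → Maybe (fromℤ i ≡ fromℤ j)
  ℤ-coefficient≟ i j with i ℤₚ.≟ j
  ... | yes eq = just (cong fromℤ eq)
  ... | no _   = nothing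

  module Solver = RingSolver ℤ.+-*-rawRing (fromCommutativeRing commutativeRing) ℤ-morphism ℤ-coefficient≟
  open Solver public using (solve; con; _:=_; _:+_; _:*_; :-_; Polynomial)

  :# : ∀ {n} → ℕ → Polynomial n
  :# k = con (ℤ.+ k)

  :0 :1 : ∀ {n} → Polynomial n
  :0 = :# 0
  :1 = :# 1

  -- Division and order.

  _/_ : Carrier → Carrier → Carrier
  x / y = x * y ⁻¹

  /-* : ∀ x {y} → y ≢ 0# → (x / y) * y ≡ x
  /-* x {y} y≢0 = begin
    x * y ⁻¹ * y     ≡⟨ *-assoc _ _ _ ⟩
    x * (y ⁻¹ * y)   ≡⟨ cong (x *_) (trans (*-comm _ _) (⁻¹-inverse y y≢0)) ⟩
    x * 1#           ≡⟨ *-identityʳ x ⟩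
    x                ∎
    where open ≡-Reasoning

  *-cancelʳ : ∀ {x y z} → z ≢ 0# → x * z ≡ y * z → x ≡ y
  *-cancelʳ {x} {y} {z} z≢0 eq = begin
    x                ≡⟨ sym (undo x) ⟩
    x * z * z ⁻¹     ≡⟨ cong (_* z ⁻¹) eq ⟩
    y * z * z ⁻¹     ≡⟨ undo y ⟩
    y                ∎
    where
    open ≡-Reasoning
    undo : ∀ w → w * z * z ⁻¹ ≡ w
    undo w = trans (*-assoc _ _ _) (trans (cong (w *_) (⁻¹-inverse z z≢0)) (*-identityʳ w))

  x*y≡0 : ∀ {x y} → y ≢ 0# → x * y ≡ 0# → x ≡ 0#
  x*y≡0 y≢0 eq = *-cancelʳ y≢0 (trans eq (sym (zeroˡ _)))

  x-y≡0 : ∀ {x y} → x + - y ≡ 0# → x ≡ y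
  x-y≡0 {x} {y} eq = trans (solve 2 (λ x y → x := (x :+ :- y) :+ y) refl x y) (trans (cong (_+ y) eq) (+-identityˡ y))

  <-by : ∀ {x y w} → 0# < w → y + - x ≡ w → x < y
  <-by {x} {y} {w} 0<w eq = subst₂ _<_ (+-identityˡ x) lemma (+-mono-< x 0<w)
    where
    lemma : w + x ≡ y
    lemma = trans (cong (_+ x) (sym eq)) (solve 2 (λ x y → (y :+ :- x) :+ x := y) refl x y)

  0<diff : ∀ {x y} → x < y → 0# < y + - x
  0<diff {x} x<y = subst₂ _<_ (-‿inverseʳ x) refl (+-mono-< (- x) x<y)

  <⇒≢ : ∀ {x y} → x < y → x ≢ y
  <⇒≢ x<y eq = <-irrefl eq x<y

  >⇒≢ : ∀ {x y} → y < x → x ≢ y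
  >⇒≢ y<x eq = <-irrefl (sym eq) y<x

  0<x⇒x≢0 : ∀ {x} → 0# < x → x ≢ 0#
  0<x⇒x≢0 = >⇒≢

  +-pos : ∀ {x y} → 0# < x → 0# < y → 0# < x + y
  +-pos {x} {y} 0<x 0<y = <-trans 0<y (<-by 0<x (solve 2 (λ x y → (x :+ y) :+ :- y := x) refl x y))

  neg-pos : ∀ {x} → x < 0# → 0# < - x
  neg-pos {x} x<0 = subst (0# <_) (+-identityˡ _) (0<diff x<0)

  0<1 : 0# < 1#
  0<1 with compare 0# 1#
  ... | tri< lt _ _ = lt
  ... | tri≈ _ eq _ = ⊥-elim (0≢1 eq)
  ... | tri> _ _ gt = ⊥-elim (<-asym gt (subst (0# <_) (solve 0 (:- :1 :* :- :1 := :1) refl) (*-pos (neg-pos gt) (neg-pos gt))))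

  fromℕ-pos : ∀ n → 0# < fromℕ (suc n)
  fromℕ-pos zero    = 0<1
  fromℕ-pos (suc n) = +-pos 0<1 (fromℕ-pos n)

  *-cancel-pos : ∀ {x y} → 0# < y → 0# < x * y → 0# < x
  *-cancel-pos {x} {y} 0<y 0<xy with compare 0# x
  ... | tri< lt _ _ = lt
  ... | tri≈ _ eq _ = ⊥-elim (<-irrefl (sym (trans (cong (_* y) (sym eq)) (zeroˡ y))) 0<xy)
  ... | tri> _ _ gt = ⊥-elim (<-asym 0<xy (<-by (*-pos (neg-pos gt) 0<y) (solve 2 (λ x y → :0 :+ :- (x :* y) := :- x :* y) refl x y)))

  /-pos : ∀ {x y} → 0# < x → 0# < y → 0# < x / y
  /-pos 0<x 0<y = *-cancel-pos 0<y (subst (0# <_) (sym (/-* _ (0<x⇒x≢0 0<y))) 0<x)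

  *-monoʳ-< : ∀ {x y z} → 0# < z → x < y → x * z < y * z
  *-monoʳ-< {x} {y} {z} 0<z x<y = <-by (*-pos (0<diff x<y) 0<z) (solve 3 (λ x y z → (y :* z) :+ :- (x :* z) := (y :+ :- x) :* z) refl x y z)

  *-cancelʳ-< : ∀ {x y z} → 0# < z → x * z < y * z → x < y
  *-cancelʳ-< {x} {y} {z} 0<z lt = <-by (*-cancel-pos 0<z (subst (0# <_) (solve 3 (λ x y z → (y :* z) :+ :- (x :* z) := (y :+ :- x) :* z) refl x y z) (0<diff lt))) refl

  ≤-<-trans : ∀ {x y z} → x ≤ y → y < z → x < z
  ≤-<-trans (inj₁ x<y) y<z = <-trans x<y y<z
  ≤-<-trans (inj₂ refl) y<z = y<z

  -- The supremum of { 0 } ∪ { 1 ∣ A } is smaller than 1 exactly if A fails.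
  weak-excluded-middle : (A : Set) → ¬ A ⊎ ¬ ¬ A
  weak-excluded-middle A with complete (λ x → x ≡ 0# ⊎ (x ≡ 1# × A)) (0# , inj₁ refl) (1# , bounded)
    where
    bounded : ∀ x → x ≡ 0# ⊎ (x ≡ 1# × A) → x ≤ 1#
    bounded x (inj₁ eq)       = inj₁ (subst (_< 1#) (sym eq) 0<1)
    bounded x (inj₂ (eq , _)) = inj₂ eq
  ... | s , upper , least = decide (compare s 1#)
    where
    s<1-if-¬A : ¬ A → s < 1#
    s<1-if-¬A ¬a = ≤-<-trans (least 0# λ { _ (inj₁ eq) → inj₂ eq ; _ (inj₂ (_ , a)) → ⊥-elim (¬a a) }) 0<1
    decide : Tri (s < 1#) (s ≡ 1#) (1# < s) → ¬ A ⊎ ¬ ¬ A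
    decide (tri< s<1 _ _) = inj₁ λ a → <-irrefl refl (≤-<-trans (upper 1# (inj₂ (refl , a))) s<1)
    decide (tri≈ s≮1 _ _) = inj₂ λ ¬a → s≮1 (s<1-if-¬A ¬a)
    decide (tri> s≮1 _ _) = inj₂ λ ¬a → s≮1 (s<1-if-¬A ¬a)

  -- The property holds on a right neighbourhood of 0. Requirements on a perturbation take this
  -- form, so that finitely many of them can be met by one `ε`.
  Small : (Carrier → Set) → Set
  Small P = ∃ λ δ → 0# < δ × (∀ ε → 0# < ε → ε < δ → P ε)

  Small-map : ∀ {P Q} → (∀ ε → 0# < ε → P ε → Q ε) → Small P → Small Q
  Small-map f (δ , 0<δ , p) = δ , 0<δ , λ ε 0<ε ε<δ → f ε 0<ε (p ε 0<ε ε<δ)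

  Small-× : ∀ {P Q} → Small P → Small Q → Small (λ ε → P ε × Q ε)
  Small-× (δ , 0<δ , p) (δ′ , 0<δ′ , q) with compare δ δ′
  ... | tri< lt _ _   = δ , 0<δ , λ ε 0<ε ε<δ → p ε 0<ε ε<δ , q ε 0<ε (<-trans ε<δ lt)
  ... | tri≈ _ refl _ = δ , 0<δ , λ ε 0<ε ε<δ → p ε 0<ε ε<δ , q ε 0<ε ε<δ
  ... | tri> _ _ gt   = δ′ , 0<δ′ , λ ε 0<ε ε<δ → p ε 0<ε (<-trans ε<δ gt) , q ε 0<ε ε<δ

  Small-All : ∀ {A : Set} {P : Carrier → A → Set} {xs : List A} → All (λ x → Small (λ ε → P ε x)) xs → Small (λ ε → All (P ε) xs)
  Small-All []       = 1# , 0<1 , λ _ _ _ → []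
  Small-All (p ∷ ps) = Small-map (λ _ _ (x , xs) → x ∷ xs) (Small-× p (Small-All ps))

  Small-witness : ∀ {P} → Small P → ∃ λ ε → 0# < ε × P ε
  Small-witness (δ , 0<δ , p) = ε , 0<ε , p ε 0<ε (<-by 0<ε (trans (cong (_+ - ε) (sym 2ε≡δ)) (solve 1 (λ e → (e :* (:1 :+ :1)) :+ :- e := e) refl ε)))
    where
    0<2 = +-pos 0<1 0<1
    ε = δ / (1# + 1#)
    0<ε = /-pos 0<δ 0<2
    2ε≡δ = /-* δ (0<x⇒x≢0 0<2)

  -- Other smallness conditions are reduced to this linear one. The sign of the coefficient `k` is
  -- not under control; unless it is positive, every positive `ε` will do.
  small-multiple : ∀ k {η} → 0# < η → Small (λ ε → k * ε < η)
  small-multiple k {η} 0<η with compare 0# k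
  ... | tri< 0<k _ _ = η / k , /-pos 0<η 0<k , λ ε _ ε<δ →
    subst₂ _<_ (*-comm ε k) (/-* η (0<x⇒x≢0 0<k)) (*-monoʳ-< 0<k ε<δ)
  ... | tri≈ _ 0≡k _ = 1# , 0<1 , λ ε _ _ → subst (_< η) (sym (trans (cong (_* ε) (sym 0≡k)) (zeroˡ ε))) 0<η
  ... | tri> _ _ k<0 = 1# , 0<1 , λ ε 0<ε _ →
    <-by (+-pos 0<η (*-pos (neg-pos k<0) 0<ε)) (solve 3 (λ k e η → η :+ :- (k :* e) := η :+ (:- k :* e)) refl k ε η)

-- Lines, segments and rays

module Lines (R : RealField) where
  open RealField R
  open Geometry R
  open OrderedField R

  lin : Point → Point → Carrier → Point
  lin a b ρ = a ⊕ (ρ · (b ⊖ a))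

  lin-0 : ∀ a b → lin a b 0# ≡ a
  lin-0 a b = cong₂ _,_ (component (proj₁ a) (proj₁ b)) (component (proj₂ a) (proj₂ b))
    where
    component : ∀ x y → x + 0# * (y + - x) ≡ x
    component = solve 2 (λ x y → x :+ :0 :* (y :+ :- x) := x) refl

  lin-1 : ∀ a b → lin a b 1# ≡ b
  lin-1 a b = cong₂ _,_ (component (proj₁ a) (proj₁ b)) (component (proj₂ a) (proj₂ b))
    where
    component : ∀ x y → x + 1# * (y + - x) ≡ y
    component = solve 2 (λ x y → x :+ :1 :* (y :+ :- x) := y) refl

  record Hit (a b a′ b′ : Point) (ρ σ : Carrier) : Set where
    constructor hit
    field
      meet   : lin a b ρ ≡ lin a′ b′ σ
      unique : ∀ {ρ′ σ′} → lin a b ρ′ ≡ lin a′ b′ σ′ → ρ′ ≡ ρ × σ′ ≡ σ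

  Hit-sym : ∀ {a b a′ b′ ρ σ} → Hit a b a′ b′ ρ σ → Hit a′ b′ a b σ ρ
  Hit-sym (hit m u) = hit (sym m) λ eq → let p , q = u (sym eq) in q , p

  data Kind : Set where
    segment ray : Kind

  Inside : Kind → Carrier → Set
  Inside segment ρ = 0# < ρ × ρ < 1#
  Inside ray     ρ = 0# < ρ

  record Piece : Set where
    constructor piece
    field
      kind    : Kind
      src tgt : Point
  open Piece public

  segmentPiece : Segment → Piece
  segmentPiece (seg a b _) = piece segment a b

  rayPiece : Ray → Piece
  rayPiece (ray a b _) = piece ray a b

  Crossing : Piece → Piece → Set
  Crossing P Q = ∃ λ ρ → ∃ λ σ → Inside (kind P) ρ × Inside (kind Q) σ × Hit (src P) (tgt P) (src Q) (tgt Q) ρ σ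

  Crossing-sym : ∀ {P Q} → Crossing P Q → Crossing Q P
  Crossing-sym (ρ , σ , iρ , iσ , h) = σ , ρ , iσ , iρ , Hit-sym h

  Meets : Segment → Segment → Set
  Meets s t = ∃ λ p → p ∈S s × p ∈S t

  Meets-sym : ∀ s t → Meets s t → Meets t s
  Meets-sym _ _ (p , p∈s , p∈t) = p , p∈t , p∈s

  crossing⇒meets : ∀ s t → Crossing (segmentPiece s) (segmentPiece t) → Meets s t
  crossing⇒meets _ _ (ρ , σ , (0<ρ , ρ<1) , (0<σ , σ<1) , h) =
    _ , (ρ , inj₁ 0<ρ , inj₁ ρ<1 , refl) , (σ , inj₁ 0<σ , inj₁ σ<1 , Hit.meet h)

  crossing⇒CrossRS : ∀ r s → Crossing (rayPiece r) (segmentPiece s) → CrossRS r s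
  crossing⇒CrossRS (ray a b _) (seg a′ b′ _) (ρ , σ , 0<ρ , (0<σ , σ<1) , hit m u) =
    lin a b ρ , (ρ , inj₁ 0<ρ , refl) , (σ , inj₁ 0<σ , inj₁ σ<1 , m) ,
    (λ { q (ρ′ , _ , eq) (σ′ , _ , _ , eq′) → trans eq (cong (lin a b) (proj₁ (u (trans (sym eq) eq′)))) }) ,
    (λ eq → <⇒≢ 0<ρ (proj₁ (u (trans (lin-0 a b) (trans (sym eq) m))))) ,
    (λ { (inj₁ eq) → <⇒≢ 0<σ (proj₂ (u (trans eq (sym (lin-0 a′ b′)))))
       ; (inj₂ eq) → >⇒≢ σ<1 (proj₂ (u (trans eq (sym (lin-1 a′ b′))))) })

  crossing⇒CrossRR : ∀ r r′ → Crossing (rayPiece r) (rayPiece r′) → CrossRR r r′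
  crossing⇒CrossRR (ray a b _) (ray a′ b′ _) (ρ , σ , 0<ρ , 0<σ , hit m u) =
    lin a b ρ , (ρ , inj₁ 0<ρ , refl) , (σ , inj₁ 0<σ , m) ,
    (λ { q (ρ′ , _ , eq) (σ′ , _ , eq′) → trans eq (cong (lin a b) (proj₁ (u (trans (sym eq) eq′)))) }) ,
    (λ eq → <⇒≢ 0<ρ (proj₁ (u (trans (lin-0 a b) (trans (sym eq) m))))) ,
    (λ eq → <⇒≢ 0<σ (proj₂ (u (trans eq (sym (lin-0 a′ b′))))))

  Tip : Carrier → Set
  Tip ρ = ρ ≡ 0# ⊎ ρ ≡ 1#

  -- The ray is normalised so that its second defining point is the tip of `t`. In coordinates along
  -- the ray, `s` therefore sits at abscissa 0 and the tip at abscissa 1. As uniqueness of a hit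
  -- concerns whole lines, the ray meets no further points of the two segments.
  Starts : Piece → Piece → Piece → Set
  Starts r s t = (∃ λ ρ → Inside segment ρ × Hit (src r) (tgt r) (src s) (tgt s) 0# ρ) ×
                 (∃ λ ρ → Tip ρ × Hit (src r) (tgt r) (src t) (tgt t) 1# ρ)

  starts⇒StartsIn : ∀ r s t → Starts (rayPiece r) (segmentPiece s) (segmentPiece t) → StartsIn r s t
  starts⇒StartsIn (ray o e _) (seg a b _) (seg a′ b′ _) ((ρ , (0<ρ , ρ<1) , hit m u) , (ρ′ , tip , hit m′ u′)) =
    ((ρ , inj₁ 0<ρ , inj₁ ρ<1 , trans (sym (lin-0 o e)) m) ,
     (λ { (inj₁ eq) → <⇒≢ 0<ρ (proj₂ (u (trans (lin-0 o e) (trans eq (sym (lin-0 a b))))))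
        ; (inj₂ eq) → >⇒≢ ρ<1 (proj₂ (u (trans (lin-0 o e) (trans eq (sym (lin-1 a b)))))) })) ,
    (e , end tip , (1# , inj₁ 0<1 , sym (lin-1 o e)) ,
     λ { p (τ , _ , eq) (inj₁ (σ , _ , _ , eq′)) →
           inj₁ (trans eq (trans (cong (lin o e) (proj₁ (u (trans (sym eq) eq′)))) (lin-0 o e)))
       ; p (τ , _ , eq) (inj₂ (σ , _ , _ , eq′)) →
           inj₂ (trans eq (trans (cong (lin o e) (proj₁ (u′ (trans (sym eq) eq′)))) (lin-1 o e))) })
    where
    end : Tip ρ′ → e ≡ a′ ⊎ e ≡ b′
    end (inj₁ refl) = inj₁ (trans (sym (lin-1 o e)) (trans m′ (lin-0 a′ b′)))
    end (inj₂ refl) = inj₂ (trans (sym (lin-1 o e)) (trans m′ (lin-1 a′ b′)))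

  det : Point → Point → Carrier
  det (u₁ , u₂) (w₁ , w₂) = u₁ * w₂ + - (u₂ * w₁)

  -- If the directions u, w were parallel, then u₂ w = w₂ u and u₁ w = w₁ u would give further
  -- common points of the two lines, unless u = 0.
  hit⇒det≢0 : ∀ {a b a′ b′ ρ σ} → a ≢ b → Hit a b a′ b′ ρ σ → det (b ⊖ a) (b′ ⊖ a′) ≢ 0#
  hit⇒det≢0 {a} {b} {a′} {b′} {ρ} {σ} a≢b (hit m u) det≡0 =
    a≢b (cong₂ _,_ (sym (x-y≡0 (vanish u₁ w₁ (parallel₁₁ , parallel₁₂)))) (sym (x-y≡0 (vanish u₂ w₂ (parallel₂₁ , parallel₂₂)))))
    where
    u₁ = proj₁ b + - proj₁ a
    u₂ = proj₂ b + - proj₂ a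
    w₁ = proj₁ b′ + - proj₁ a′
    w₂ = proj₂ b′ + - proj₂ a′
    parallel₁₁ : w₁ * u₁ ≡ u₁ * w₁
    parallel₁₁ = *-comm w₁ u₁
    parallel₂₂ : w₂ * u₂ ≡ u₂ * w₂
    parallel₂₂ = *-comm w₂ u₂
    u₁w₂≡u₂w₁ : u₁ * w₂ ≡ u₂ * w₁
    u₁w₂≡u₂w₁ = x-y≡0 det≡0
    parallel₁₂ : w₁ * u₂ ≡ u₁ * w₂
    parallel₁₂ = trans (*-comm w₁ u₂) (sym u₁w₂≡u₂w₁)
    parallel₂₁ : w₂ * u₁ ≡ u₂ * w₁
    parallel₂₁ = trans (*-comm w₂ u₁) u₁w₂≡u₂w₁
    shift : ∀ x y p q v w → x + ρ * v ≡ y + σ * w → p * v ≡ q * w → x + (ρ + p) * v ≡ y + (σ + q) * w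
    shift x y p q v w eq eq′ = begin
      x + (ρ + p) * v       ≡⟨ solve 4 (λ x r p v → x :+ (r :+ p) :* v := (x :+ r :* v) :+ p :* v) refl x ρ p v ⟩
      x + ρ * v + p * v     ≡⟨ cong₂ _+_ eq eq′ ⟩
      y + σ * w + q * w     ≡⟨ solve 4 (λ x r p v → (x :+ r :* v) :+ p :* v := x :+ (r :+ p) :* v) refl y σ q w ⟩
      y + (σ + q) * w       ∎
      where open ≡-Reasoning
    vanish : ∀ c k → k * u₁ ≡ c * w₁ × k * u₂ ≡ c * w₂ → c ≡ 0#
    vanish c k (eq₁ , eq₂) = begin
      c                 ≡⟨ solve 2 (λ s c → c := (s :+ c) :+ :- s) refl σ c ⟩
      σ + c + - σ       ≡⟨ cong (_+ - σ) (proj₂ (u (cong₂ _,_ (shift _ _ k c _ _ (cong proj₁ m) eq₁) (shift _ _ k c _ _ (cong proj₂ m) eq₂)))) ⟩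
      σ + - σ           ≡⟨ -‿inverseʳ σ ⟩
      0#                ∎
      where open ≡-Reasoning

  -- Affine coordinates along the axis.

  Affine : Set
  Affine = Carrier × Carrier

  value : Affine → Carrier → Carrier
  value (q₀ , q₁) t = q₀ + q₁ * t

  slope : Affine → Carrier
  slope = proj₂

  -- The axis is the line of ordinate 0, with `O` at (0, 0) and `e` at (1, 0). The second direction
  -- `e₂` is left free because it will be taken along a segment, in either orientation.
  module Frame (O e e₂ : Point) (det≢0 : det (e ⊖ O) e₂ ≢ 0#) where

    e₁ : Point
    e₁ = e ⊖ O

    at : Carrier → Carrier → Point
    at t y = O ⊕ ((t · e₁) ⊕ (y · e₂))

    -- The determinants of the difference vector, with `e₂` as second or `e₁` as first argument, are
    -- `det e₁ e₂` times the difference of the abscissae or of the ordinates.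
    at-injective : ∀ {t y t′ y′} → at t y ≡ at t′ y′ → t ≡ t′ × y ≡ y′
    at-injective {t} {y} {t′} {y′} eq =
      x-y≡0 (x*y≡0 det≢0 (trans
        (solve 6 (λ u v E₁ E₂ d₁ d₂ → u :* (E₁ :* d₂ :+ :- (E₂ :* d₁)) := (u :* E₁ :+ v :* d₁) :* d₂ :+ :- ((u :* E₂ :+ v :* d₂) :* d₁))
           refl (t + - t′) (y + - y′) E₁ E₂ d₁ d₂)
        (vanish d₂ d₁))) ,
      x-y≡0 (x*y≡0 det≢0 (trans
        (solve 6 (λ u v E₁ E₂ d₁ d₂ → v :* (E₁ :* d₂ :+ :- (E₂ :* d₁)) := (u :* E₁ :+ v :* d₁) :* :- E₂ :+ :- ((u :* E₂ :+ v :* d₂) :* :- E₁))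
           refl (t + - t′) (y + - y′) E₁ E₂ d₁ d₂)
        (vanish (- E₂) (- E₁))))
      where
      E₁ = proj₁ e₁
      E₂ = proj₂ e₁
      d₁ = proj₁ e₂
      d₂ = proj₂ e₂
      difference : ∀ {o E d} → o + (t * E + y * d) ≡ o + (t′ * E + y′ * d) → (t + - t′) * E + (y + - y′) * d ≡ 0#
      difference {o} {E} {d} eq = trans
        (solve 7 (λ o t t′ E y y′ d → (t :+ :- t′) :* E :+ (y :+ :- y′) :* d := (o :+ (t :* E :+ y :* d)) :+ :- (o :+ (t′ :* E :+ y′ :* d))) refl o t t′ E y y′ d)
        (trans (cong (_+ - (o + (t′ * E + y′ * d))) eq) (-‿inverseʳ _))
      vanish : ∀ k l → ((t + - t′) * E₁ + (y + - y′) * d₁) * k + - (((t + - t′) * E₂ + (y + - y′) * d₂) * l) ≡ 0#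
      vanish k l = trans
        (cong₂ (λ a b → a * k + - (b * l)) (difference (cong proj₁ eq)) (difference (cong proj₂ eq)))
        (solve 2 (λ k l → :0 :* k :+ :- (:0 :* l) := :0) refl k l)

    -- Cramer's rule.
    coordinates : ∀ w → ∃ λ w₁ → ∃ λ w₂ → w ≡ (w₁ · e₁) ⊕ (w₂ · e₂)
    coordinates (x , y) = (x * d₂ + - (y * d₁)) / D , (E₁ * y + - (E₂ * x)) / D ,
      cong₂ _,_ (*-cancelʳ det≢0 (trans cramer₁ (sym (scale E₁ d₁)))) (*-cancelʳ det≢0 (trans cramer₂ (sym (scale E₂ d₂))))
      where
      open ≡-Reasoning
      E₁ = proj₁ e₁
      E₂ = proj₂ e₁
      d₁ = proj₁ e₂
      d₂ = proj₂ e₂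
      D = det e₁ e₂
      p = x * d₂ + - (y * d₁)
      q = E₁ * y + - (E₂ * x)
      scale : ∀ k l → (p / D * k + q / D * l) * D ≡ p * k + q * l
      scale k l = begin
        (p / D * k + q / D * l) * D          ≡⟨ solve 5 (λ a b k l D → (a :* k :+ b :* l) :* D := (a :* D) :* k :+ (b :* D) :* l) refl (p / D) (q / D) k l D ⟩
        p / D * D * k + q / D * D * l        ≡⟨ cong₂ (λ a b → a * k + b * l) (/-* p det≢0) (/-* q det≢0) ⟩
        p * k + q * l                        ∎
      cramer₁ : x * D ≡ p * E₁ + q * d₁
      cramer₁ = solve 6 (λ x y E₁ E₂ d₁ d₂ → x :* (E₁ :* d₂ :+ :- (E₂ :* d₁)) := (x :* d₂ :+ :- (y :* d₁)) :* E₁ :+ (E₁ :* y :+ :- (E₂ :* x)) :* d₁) refl x y E₁ E₂ d₁ d₂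
      cramer₂ : y * D ≡ p * E₂ + q * d₂
      cramer₂ = solve 6 (λ x y E₁ E₂ d₁ d₂ → y :* (E₁ :* d₂ :+ :- (E₂ :* d₁)) := (x :* d₂ :+ :- (y :* d₁)) :* E₂ :+ (E₁ :* y :+ :- (E₂ :* x)) :* d₂) refl x y E₁ E₂ d₁ d₂

    -- The line through a and b crosses the axis at t₀, for the parameter ρ₀, and has inverse slope g.
    record Transversal (a b : Point) (t₀ ρ₀ g D : Carrier) : Set where
      constructor transversal
      field
        D≢0   : D ≢ 0#
        curve : ∀ ρ → lin a b ρ ≡ at (t₀ + g * ((ρ + - ρ₀) * D)) ((ρ + - ρ₀) * D)

    -- With `w₁` and `w₂` the components of the direction `b ⊖ a`, `D` is `w₂` and `g` is `w₁ / w₂`.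
    -- If `w₂` vanished, raising the two parameters by `w₁` and by 1 would give another pair of
    -- parameters for a common point.
    hit⇒transversal : ∀ {a b t₀ ρ₀} → Hit O e a b t₀ ρ₀ → ∃ λ g → ∃ λ D → Transversal a b t₀ ρ₀ g D
    hit⇒transversal {a} {b} {t₀} {ρ₀} (hit m u) = w₁ / w₂ , w₂ , transversal w₂≢0
        λ ρ → cong₂ _,_ (component (cong proj₁ m) (cong proj₁ w≡)) (component (cong proj₂ m) (cong proj₂ w≡))
      where
      open ≡-Reasoning
      w₁ = proj₁ (coordinates (b ⊖ a))
      w₂ = proj₁ (proj₂ (coordinates (b ⊖ a)))
      w≡ = proj₂ (proj₂ (coordinates (b ⊖ a)))
      shift : ∀ {o E d x v} → w₂ ≡ 0# → o + t₀ * E ≡ x + ρ₀ * v → v ≡ w₁ * E + w₂ * d → o + (t₀ + w₁) * E ≡ x + (ρ₀ + 1#) * v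
      shift {o} {E} {d} {x} {v} w₂≡0 eq eq′ = begin
        o + (t₀ + w₁) * E               ≡⟨ solve 5 (λ o t w E d → o :+ (t :+ w) :* E := (o :+ t :* E) :+ (w :* E :+ :0 :* d)) refl o t₀ w₁ E d ⟩
        o + t₀ * E + (w₁ * E + 0# * d)  ≡⟨ cong (λ z → o + t₀ * E + (w₁ * E + z * d)) (sym w₂≡0) ⟩
        o + t₀ * E + (w₁ * E + w₂ * d)  ≡⟨ cong₂ _+_ eq (sym eq′) ⟩
        x + ρ₀ * v + v                  ≡⟨ solve 3 (λ x r v → (x :+ r :* v) :+ v := x :+ (r :+ :1) :* v) refl x ρ₀ v ⟩
        x + (ρ₀ + 1#) * v               ∎
      w₂≢0 : w₂ ≢ 0#
      w₂≢0 w₂≡0 = 0≢1 (begin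
        0#                  ≡⟨ sym (-‿inverseʳ ρ₀) ⟩
        ρ₀ + - ρ₀           ≡⟨ cong (_+ - ρ₀) (sym (proj₂ (u (cong₂ _,_ (shift w₂≡0 (cong proj₁ m) (cong proj₁ w≡)) (shift w₂≡0 (cong proj₂ m) (cong proj₂ w≡)))))) ⟩
        ρ₀ + 1# + - ρ₀      ≡⟨ solve 1 (λ r → (r :+ :1) :+ :- r := :1) refl ρ₀ ⟩
        1#                  ∎)
      component : ∀ {ρ o E d x v} → o + t₀ * E ≡ x + ρ₀ * v → v ≡ w₁ * E + w₂ * d →
        x + ρ * v ≡ o + ((t₀ + w₁ / w₂ * ((ρ + - ρ₀) * w₂)) * E + ((ρ + - ρ₀) * w₂) * d)
      component {ρ} {o} {E} {d} {x} {v} eq eq′ = begin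
        x + ρ * v
          ≡⟨ solve 4 (λ x r s v → x :+ r :* v := (x :+ s :* v) :+ (r :+ :- s) :* v) refl x ρ ρ₀ v ⟩
        x + ρ₀ * v + (ρ + - ρ₀) * v
          ≡⟨ cong₂ (λ p q → p + (ρ + - ρ₀) * q) (sym eq) eq′ ⟩
        o + t₀ * E + (ρ + - ρ₀) * (w₁ * E + w₂ * d)
          ≡⟨ cong (λ z → o + t₀ * E + (ρ + - ρ₀) * (z * E + w₂ * d)) (sym (/-* w₁ w₂≢0)) ⟩
        o + t₀ * E + (ρ + - ρ₀) * (w₁ / w₂ * w₂ * E + w₂ * d)
          ≡⟨ solve 7 (λ o t E k g w d → (o :+ t :* E) :+ k :* ((g :* w) :* E :+ w :* d) := o :+ ((t :+ g :* (k :* w)) :* E :+ (k :* w) :* d)) refl o t₀ E (ρ + - ρ₀) (w₁ / w₂) w₂ d ⟩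
        o + ((t₀ + w₁ / w₂ * ((ρ + - ρ₀) * w₂)) * E + ((ρ + - ρ₀) * w₂) * d) ∎

    lin-at : ∀ t y t′ y′ τ → lin (at t y) (at t′ y′) τ ≡ at (t + τ * (t′ + - t)) (y + τ * (y′ + - y))
    lin-at t y t′ y′ τ = cong₂ _,_ (component (proj₁ O) (proj₁ e₁) (proj₁ e₂)) (component (proj₂ O) (proj₂ e₁) (proj₂ e₂))
      where
      component : ∀ o E d → (o + (t * E + y * d)) + τ * ((o + (t′ * E + y′ * d)) + - (o + (t * E + y * d))) ≡ o + ((t + τ * (t′ + - t)) * E + (y + τ * (y′ + - y)) * d)
      component o E d = solve 8 (λ o E d t y t′ y′ s → (o :+ (t :* E :+ y :* d)) :+ s :* ((o :+ (t′ :* E :+ y′ :* d)) :+ :- (o :+ (t :* E :+ y :* d))) := o :+ ((t :+ s :* (t′ :+ :- t)) :* E :+ (y :+ s :* (y′ :+ :- y)) :* d)) refl o E d t y t′ y′ τ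

    -- The scale `ε` brings lines close to the axis without moving the abscissae at which they
    -- vanish or meet each other. The arrangement of the new objects can thus be fixed before `ε` is
    -- chosen.
    graph : Carrier → Affine → Carrier → Point
    graph ε q t = at t (ε * value q t)

    lin-graph : ∀ ε q t₁ t₂ τ → lin (graph ε q t₁) (graph ε q t₂) τ ≡ graph ε q (t₁ + τ * (t₂ + - t₁))
    lin-graph ε (q₀ , q₁) t₁ t₂ τ = trans (lin-at _ _ _ _ τ) (cong (at _)
      (solve 6 (λ e q₀ q₁ t₁ t₂ s → e :* (q₀ :+ q₁ :* t₁) :+ s :* (e :* (q₀ :+ q₁ :* t₂) :+ :- (e :* (q₀ :+ q₁ :* t₁))) := e :* (q₀ :+ q₁ :* (t₁ :+ s :* (t₂ :+ :- t₁)))) refl ε q₀ q₁ t₁ t₂ τ))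

    parameter-unique : ∀ {t₁ t₂ τ τ′} → t₁ ≢ t₂ → t₁ + τ * (t₂ + - t₁) ≡ t₁ + τ′ * (t₂ + - t₁) → τ ≡ τ′
    parameter-unique {t₁} {t₂} {τ} {τ′} t₁≢t₂ eq = *-cancelʳ (λ z → t₁≢t₂ (sym (x-y≡0 z))) (begin
      τ * (t₂ + - t₁)                  ≡⟨ solve 2 (λ a b → b := (a :+ b) :+ :- a) refl t₁ _ ⟩
      t₁ + τ * (t₂ + - t₁) + - t₁      ≡⟨ cong (_+ - t₁) eq ⟩
      t₁ + τ′ * (t₂ + - t₁) + - t₁     ≡⟨ solve 2 (λ a b → (a :+ b) :+ :- a := b) refl t₁ _ ⟩
      τ′ * (t₂ + - t₁)                 ∎)
      where open ≡-Reasoning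

    -- Both ordinates are fixed points of the map that sends `y` to `ε * value q (t₀ + g * y)`. It
    -- is affine with slope `ε * (slope q * g)`, which is not 1.
    fixed-point-unique : ∀ {ε t₀ g q y y′} → 1# + - (ε * (slope q * g)) ≢ 0# →
      y ≡ ε * value q (t₀ + g * y) → y′ ≡ ε * value q (t₀ + g * y′) → y ≡ y′
    fixed-point-unique {ε} {t₀} {g} {q₀ , q₁} {y} {y′} c≢0 eq eq′ = *-cancelʳ c≢0 (trans (factor eq) (sym (factor eq′)))
      where
      open ≡-Reasoning
      factor : ∀ {y} → y ≡ ε * (q₀ + q₁ * (t₀ + g * y)) → y * (1# + - (ε * (q₁ * g))) ≡ ε * (q₀ + q₁ * t₀)
      factor {y} eq = begin
        y * (1# + - (ε * (q₁ * g)))                                    ≡⟨ solve 4 (λ y e q g → y :* (:1 :+ :- (e :* (q :* g))) := y :+ :- (y :* (e :* (q :* g)))) refl y ε q₁ g ⟩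
        y + - (y * (ε * (q₁ * g)))                                     ≡⟨ cong (_+ - (y * (ε * (q₁ * g)))) eq ⟩
        ε * (q₀ + q₁ * (t₀ + g * y)) + - (y * (ε * (q₁ * g)))          ≡⟨ solve 6 (λ y e q₀ q g t → e :* (q₀ :+ q :* (t :+ g :* y)) :+ :- (y :* (e :* (q :* g))) := e :* (q₀ :+ q :* t)) refl y ε q₀ q₁ g t₀ ⟩
        ε * (q₀ + q₁ * t₀)                                             ∎

    -- `y`, `τ` and `ρ` are given by equations and not by formulas, since two kinds of solution
    -- occur: the general one, and `y = 0` for a graph that passes exactly through the point where
    -- the transversal crosses the axis.
    hit-transversal : ∀ {a b t₀ ρ₀ g D ε q t₁ t₂ y τ ρ} → Transversal a b t₀ ρ₀ g D →
      t₁ ≢ t₂ → 1# + - (ε * (slope q * g)) ≢ 0# → y ≡ ε * value q (t₀ + g * y) →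
      t₁ + τ * (t₂ + - t₁) ≡ t₀ + g * y → (ρ + - ρ₀) * D ≡ y → Hit (graph ε q t₁) (graph ε q t₂) a b τ ρ
    hit-transversal {a} {b} {t₀} {ρ₀} {g} {D} {ε} {q} {t₁} {t₂} {y} {τ} {ρ} (transversal D≢0 curve) t₁≢t₂ c≢0 y≡ τ≡ ρ≡ = hit
      (begin
        lin (graph ε q t₁) (graph ε q t₂) τ                              ≡⟨ lin-graph ε q t₁ t₂ τ ⟩
        graph ε q (t₁ + τ * (t₂ + - t₁))                                 ≡⟨ cong (graph ε q) τ≡ ⟩
        at (t₀ + g * y) (ε * value q (t₀ + g * y))                       ≡⟨ cong (at (t₀ + g * y)) (sym y≡) ⟩
        at (t₀ + g * y) y                                                ≡⟨ cong (λ z → at (t₀ + g * z) z) (sym ρ≡) ⟩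
        at (t₀ + g * ((ρ + - ρ₀) * D)) ((ρ + - ρ₀) * D)                  ≡⟨ sym (curve ρ) ⟩
        lin a b ρ                                                        ∎)
      unique
      where
      open ≡-Reasoning
      unique : ∀ {τ′ ρ′} → lin (graph ε q t₁) (graph ε q t₂) τ′ ≡ lin a b ρ′ → τ′ ≡ τ × ρ′ ≡ ρ
      unique {τ′} {ρ′} eq = parameter-unique t₁≢t₂ (trans T≡ (trans (cong (λ z → t₀ + g * z) y′≡y) (sym τ≡))) ,
          x-y≡0 (trans (solve 3 (λ r s k → r :+ :- s := (r :+ :- k) :+ :- (s :+ :- k)) refl ρ′ ρ ρ₀)
            (trans (cong (_+ - (ρ + - ρ₀)) (*-cancelʳ D≢0 (trans y′≡y (sym ρ≡)))) (-‿inverseʳ _)))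
        where
        y′ = (ρ′ + - ρ₀) * D
        both = at-injective (trans (sym (lin-graph ε q t₁ t₂ τ′)) (trans eq (curve ρ′)))
        T≡ : t₁ + τ′ * (t₂ + - t₁) ≡ t₀ + g * y′
        T≡ = proj₁ both
        y′≡y : y′ ≡ y
        y′≡y = fixed-point-unique {ε} {t₀} {g} {q} c≢0 (trans (sym (proj₂ both)) (cong (λ z → ε * value q z) T≡)) y≡

    -- Once `ε` is cancelled, a common abscissa `T` solves `value q T ≡ value q′ T`, and affine
    -- functions of different slopes agree only once.
    hit-graph : ∀ {ε q q′ t₁ t₂ t₁′ t₂′ t τ τ′} → 0# < ε → t₁ ≢ t₂ → t₁′ ≢ t₂′ → slope q ≢ slope q′ → value q t ≡ value q′ t →
      t₁ + τ * (t₂ + - t₁) ≡ t → t₁′ + τ′ * (t₂′ + - t₁′) ≡ t →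
      Hit (graph ε q t₁) (graph ε q t₂) (graph ε q′ t₁′) (graph ε q′ t₂′) τ τ′
    hit-graph {ε} {q} {q′} {t₁} {t₂} {t₁′} {t₂′} {t} {τ} {τ′} 0<ε t₁≢t₂ t₁′≢t₂′ s≢s′ q≡q′ τ≡ τ′≡ = hit
      (begin
        lin (graph ε q t₁) (graph ε q t₂) τ            ≡⟨ lin-graph ε q t₁ t₂ τ ⟩
        graph ε q (t₁ + τ * (t₂ + - t₁))               ≡⟨ cong (graph ε q) τ≡ ⟩
        at t (ε * value q t)                           ≡⟨ cong (λ z → at t (ε * z)) q≡q′ ⟩
        graph ε q′ t                                   ≡⟨ cong (graph ε q′) (sym τ′≡) ⟩
        graph ε q′ (t₁′ + τ′ * (t₂′ + - t₁′))          ≡⟨ sym (lin-graph ε q′ t₁′ t₂′ τ′) ⟩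
        lin (graph ε q′ t₁′) (graph ε q′ t₂′) τ′       ∎)
      unique
      where
      open ≡-Reasoning
      abscissa : ∀ {T} → value q T ≡ value q′ T → T ≡ t
      abscissa {T} eq = x-y≡0 (x*y≡0 (λ z → s≢s′ (x-y≡0 z)) (begin
        (T + - t) * (slope q + - slope q′)
          ≡⟨ solve 6 (λ T t a b c d → (T :+ :- t) :* (b :+ :- d) := ((a :+ b :* T) :+ :- (c :+ d :* T)) :+ :- ((a :+ b :* t) :+ :- (c :+ d :* t))) refl T t (proj₁ q) (proj₂ q) (proj₁ q′) (proj₂ q′) ⟩
        (value q T + - value q′ T) + - (value q t + - value q′ t)
          ≡⟨ cong₂ (λ a b → (a + - value q′ T) + - (b + - value q′ t)) eq q≡q′ ⟩
        (value q′ T + - value q′ T) + - (value q′ t + - value q′ t)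
          ≡⟨ solve 2 (λ a b → (a :+ :- a) :+ :- (b :+ :- b) := :0) refl (value q′ T) (value q′ t) ⟩
        0# ∎))
      unique : ∀ {σ σ′} → lin (graph ε q t₁) (graph ε q t₂) σ ≡ lin (graph ε q′ t₁′) (graph ε q′ t₂′) σ′ → σ ≡ τ × σ′ ≡ τ′
      unique {σ} {σ′} eq = parameter-unique t₁≢t₂ (trans T≡t (sym τ≡)) , parameter-unique t₁′≢t₂′ (trans (sym (proj₁ both)) (trans T≡t (sym τ′≡)))
        where
        both = at-injective (trans (sym (lin-graph ε q t₁ t₂ σ)) (trans eq (lin-graph ε q′ t₁′ t₂′ σ′)))
        T = t₁ + σ * (t₂ + - t₁)
        T≡t : T ≡ t
        T≡t = abscissa (*-cancelʳ (0<x⇒x≢0 0<ε) (trans (*-comm _ _) (trans (proj₂ both) (trans (cong (λ z → ε * value q′ z) (sym (proj₁ both))) (*-comm _ _)))))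

-- Perturbing the axis

module Perturbation (R : RealField) where
  open RealField R
  open Geometry R
  open OrderedField R
  open Lines R

  -- One minus the slope of the fixed-point map, hence positive for small `ε`.
  denominator : Affine → Carrier → Carrier → Carrier
  denominator q g ε = 1# + - (ε * (slope q * g))

  -- The ordinate at which the graph of ε q meets the transversal t = t₀ + g y.
  root : Affine → Carrier → Carrier → Carrier → Carrier
  root q t₀ g ε = (ε * value q t₀) / denominator q g ε

  denominator-pos : ∀ q g → Small (λ ε → 0# < denominator q g ε)
  denominator-pos (_ , s) g = Small-map (λ ε _ lt → subst (0# <_) (cong (λ z → 1# + - z) (*-comm _ _)) (0<diff lt)) (small-multiple (s * g) 0<1)

  root-* : ∀ q t₀ g ε → 0# < denominator q g ε → root q t₀ g ε * denominator q g ε ≡ ε * value q t₀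
  root-* q t₀ g ε 0<d = /-* _ (0<x⇒x≢0 0<d)

  root-fixed : ∀ q t₀ g ε → 0# < denominator q g ε → root q t₀ g ε ≡ ε * value q (t₀ + g * root q t₀ g ε)
  root-fixed q@(q₀ , s) t₀ g ε 0<d = *-cancelʳ (0<x⇒x≢0 0<d) (begin
    y * d                                                   ≡⟨ root-* q t₀ g ε 0<d ⟩
    -- The factor 1 is split into `d` and `ε * (s * g)`; in the second summand `root-*` then brings
    -- back `y`.
    ε * value q t₀                                          ≡⟨ solve 5 (λ e q₀ s t g → e :* (q₀ :+ s :* t) := e :* (q₀ :+ s :* t) :* (:1 :+ :- (e :* (s :* g))) :+ (e :* (s :* g)) :* (e :* (q₀ :+ s :* t))) refl ε q₀ s t₀ g ⟩
    ε * value q t₀ * d + ε * (s * g) * (ε * value q t₀)     ≡⟨ cong (λ z → ε * value q t₀ * d + ε * (s * g) * z) (sym (root-* q t₀ g ε 0<d)) ⟩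
    ε * value q t₀ * d + ε * (s * g) * (y * d)              ≡⟨ solve 7 (λ e q₀ s t g y d → (e :* (q₀ :+ s :* t)) :* d :+ (e :* (s :* g)) :* (y :* d) := (e :* (q₀ :+ s :* (t :+ g :* y))) :* d) refl ε q₀ s t₀ g y d ⟩
    ε * value q (t₀ + g * y) * d                            ∎)
    where
    open ≡-Reasoning
    y = root q t₀ g ε
    d = denominator q g ε

  -- Multiplied by the positive denominator, the inequality becomes linear: a fixed multiple of `ε`
  -- has to stay below `η`.
  root-small : ∀ q t₀ g k {η} → 0# < η → Small (λ ε → k * root q t₀ g ε < η)
  root-small q@(q₀ , s) t₀ g k {η} 0<η =
    Small-map (λ ε _ (0<d , lt) → *-cancelʳ-< 0<d (<-by (0<diff lt) (begin
        η * denominator q g ε + - (k * root q t₀ g ε * denominator q g ε)     ≡⟨ cong (λ z → η * denominator q g ε + - z) (trans (*-assoc _ _ _) (cong (k *_) (root-* q t₀ g ε 0<d))) ⟩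
        η * denominator q g ε + - (k * (ε * value q t₀))                      ≡⟨ solve 7 (λ η e s g k q₀ t → η :* (:1 :+ :- (e :* (s :* g))) :+ :- (k :* (e :* (q₀ :+ s :* t))) := η :+ :- ((k :* (q₀ :+ s :* t) :+ η :* (s :* g)) :* e)) refl η ε s g k q₀ t₀ ⟩
        η + - ((k * value q t₀ + η * (s * g)) * ε)                            ∎)))
      (Small-× (denominator-pos q g) (small-multiple (k * value q t₀ + η * (s * g)) 0<η))
    where open ≡-Reasoning

  root-pos : ∀ q t₀ g → 0# < value q t₀ → Small (λ ε → 0# < root q t₀ g ε)
  root-pos q t₀ g 0<v = Small-map (λ ε 0<ε 0<d → /-pos (*-pos 0<ε 0<v) 0<d) (denominator-pos q g)

  root-neg : ∀ q t₀ g → value q t₀ < 0# → Small (λ ε → 0# < - root q t₀ g ε)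
  root-neg q t₀ g v<0 = Small-map
    (λ ε 0<ε 0<d → subst (0# <_) (solve 3 (λ e v d → (e :* :- v) :* d := :- ((e :* v) :* d)) refl ε (value q t₀) (denominator q g ε ⁻¹)) (/-pos (*-pos 0<ε (neg-pos v<0)) 0<d))
    (denominator-pos q g)

  -- A condition on abscissae instead of parameters. Rays may run in either direction, as one of the
  -- new rays runs backwards; segments are given from left to right.
  Between : Kind → Carrier → Carrier → Carrier → Set
  Between segment t₁ t₂ t = t₁ < t × t < t₂
  Between ray     t₁ t₂ t = (t₁ < t₂ × t₁ < t) ⊎ (t₂ < t₁ × t < t₁)

  between⇒≢ : ∀ k {t₁ t₂ t} → Between k t₁ t₂ t → t₁ ≢ t₂
  between⇒≢ segment (lt , lt′)      = <⇒≢ (<-trans lt lt′)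
  between⇒≢ ray     (inj₁ (lt , _)) = <⇒≢ lt
  between⇒≢ ray     (inj₂ (gt , _)) = >⇒≢ gt

  parameter : Carrier → Carrier → Carrier → Carrier
  parameter t₁ t₂ t = (t + - t₁) / (t₂ + - t₁)

  at-parameter : ∀ {t₁ t₂} t → t₁ ≢ t₂ → t₁ + parameter t₁ t₂ t * (t₂ + - t₁) ≡ t
  at-parameter {t₁} {t₂} t t₁≢t₂ = trans (cong (t₁ +_) (/-* _ λ eq → t₁≢t₂ (sym (x-y≡0 eq)))) (solve 2 (λ a t → a :+ (t :+ :- a) := t) refl t₁ t)

  at-0 : ∀ t₁ t₂ → t₁ + 0# * (t₂ + - t₁) ≡ t₁
  at-0 = solve 2 (λ a b → a :+ :0 :* (b :+ :- a) := a) refl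

  at-1 : ∀ t₁ t₂ → t₁ + 1# * (t₂ + - t₁) ≡ t₂
  at-1 = solve 2 (λ a b → a :+ :1 :* (b :+ :- a) := b) refl

  between⇒inside : ∀ k {t₁ t₂ t} → Between k t₁ t₂ t → Inside k (parameter t₁ t₂ t)
  between⇒inside segment {t₁} {t₂} {t} (lt , lt′) = /-pos (0<diff lt) pos ,
      *-cancelʳ-< pos (<-by (0<diff lt′) (trans (cong (λ z → 1# * (t₂ + - t₁) + - z) (/-* (t + - t₁) (0<x⇒x≢0 pos)))
        (solve 3 (λ a b t → :1 :* (b :+ :- a) :+ :- (t :+ :- a) := b :+ :- t) refl t₁ t₂ t)))
    where pos = 0<diff (<-trans lt lt′)
  between⇒inside ray (inj₁ (lt , lt′)) = /-pos (0<diff lt′) (0<diff lt)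
  between⇒inside ray {t₁} {t₂} {t} (inj₂ (gt , gt′)) = *-cancel-pos (0<diff gt)
    (subst (0# <_) (begin
      t₁ + - t                                   ≡⟨ solve 2 (λ a t → a :+ :- t := :- (t :+ :- a)) refl t₁ t ⟩
      - (t + - t₁)                               ≡⟨ cong -_ (sym (/-* (t + - t₁) λ eq → >⇒≢ gt (sym (x-y≡0 eq)))) ⟩
      - (parameter t₁ t₂ t * (t₂ + - t₁))        ≡⟨ solve 3 (λ p a b → :- (p :* (b :+ :- a)) := p :* (a :+ :- b)) refl (parameter t₁ t₂ t) t₁ t₂ ⟩
      parameter t₁ t₂ t * (t₁ + - t₂)            ∎) (0<diff gt′))
    where open ≡-Reasoning

  root-below : ∀ q t₀ g {x z} k → x < z → Small (λ ε → x + k * root q t₀ g ε < z)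
  root-below q t₀ g {x} {z} k x<z = Small-map
    (λ ε _ lt → <-by (0<diff lt) (solve 3 (λ x z y → z :+ :- (x :+ y) := (z :+ :- x) :+ :- y) refl x z (k * root q t₀ g ε)))
    (root-small q t₀ g k (0<diff x<z))

  root-above : ∀ q t₀ g {x z} k → x < z → Small (λ ε → x < z + k * root q t₀ g ε)
  root-above q t₀ g {x} {z} k x<z = Small-map
    (λ ε _ lt → <-by (0<diff lt) (solve 4 (λ x z k y → (z :+ k :* y) :+ :- x := (z :+ :- x) :+ :- (:- k :* y)) refl x z k (root q t₀ g ε)))
    (root-small q t₀ g (- k) (0<diff x<z))

  between-stable : ∀ q t₀ g k {t₁ t₂} → Between k t₁ t₂ t₀ → Small (λ ε → Between k t₁ t₂ (t₀ + g * root q t₀ g ε))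
  between-stable q t₀ g segment (lt , lt′)        = Small-× (root-above q t₀ g g lt) (root-below q t₀ g g lt′)
  between-stable q t₀ g ray     (inj₁ (lt , lt′)) = Small-map (λ _ _ p → inj₁ (lt , p)) (root-above q t₀ g g lt′)
  between-stable q t₀ g ray     (inj₂ (gt , gt′)) = Small-map (λ _ _ p → inj₂ (gt , p)) (root-below q t₀ g g gt′)

  inside-stable : ∀ q t₀ g k {ρ₀} h → Inside k ρ₀ → Small (λ ε → Inside k (ρ₀ + h * root q t₀ g ε))
  inside-stable q t₀ g segment h (lt , lt′) = Small-× (root-above q t₀ g h lt) (root-below q t₀ g h lt′)
  inside-stable q t₀ g ray     h lt         = root-above q t₀ g h lt

  -- As y = (ρ - ρ₀) D grows from 0, the point with parameter ρ moves from the tip ρ₀ into the segment.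
  Inward : Carrier → Carrier → Set
  Inward ρ₀ D = (ρ₀ ≡ 0# × 0# < D) ⊎ (ρ₀ ≡ 1# × D < 0#)

  ⁻¹-pos : ∀ {x} → 0# < x → 0# < x ⁻¹
  ⁻¹-pos 0<x = subst (0# <_) (*-identityˡ _) (/-pos 0<1 0<x)

  ⁻¹-neg : ∀ {x} → x < 0# → 0# < - (x ⁻¹)
  ⁻¹-neg {x} x<0 = *-cancel-pos (neg-pos x<0) (subst (0# <_) (sym (trans (solve 2 (λ x y → :- y :* :- x := x :* y) refl x (x ⁻¹)) (⁻¹-inverse x (<⇒≢ x<0)))) 0<1)

  -- At a tip the parameter is on the boundary of the domain, so `inside-stable` does not apply.
  -- What decides is that the crossing has positive ordinate and the segment leaves its tip towards
  -- that side.
  inward-inside : ∀ q t₀ g {ρ₀ D} → Inward ρ₀ D → 0# < value q t₀ → Small (λ ε → Inside segment (ρ₀ + D ⁻¹ * root q t₀ g ε))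
  inward-inside q t₀ g {D = D} (inj₁ (refl , 0<D)) 0<v = Small-map
    (λ ε _ (lt , 0<y) → subst (0# <_) (sym (+-identityˡ _)) (*-pos (⁻¹-pos 0<D) 0<y) , lt)
    (Small-× (root-below q t₀ g (D ⁻¹) 0<1) (root-pos q t₀ g 0<v))
  inward-inside q t₀ g {D = D} (inj₂ (refl , D<0)) 0<v = Small-map
    (λ ε _ (lt , 0<y) → lt , <-by (*-pos (⁻¹-neg D<0) 0<y) (solve 2 (λ h y → :1 :+ :- (:1 :+ h :* y) := :- h :* y) refl (D ⁻¹) (root q t₀ g ε)))
    (Small-× (root-above q t₀ g (D ⁻¹) 0<1) (root-pos q t₀ g 0<v))

  -- The mirror image: segment and crossing are both on the negative side.
  outward-inside : ∀ q t₀ g {ρ₀ D} → Inward ρ₀ (- D) → value q t₀ < 0# → Small (λ ε → Inside segment (ρ₀ + D ⁻¹ * root q t₀ g ε))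
  outward-inside q t₀ g {D = D} (inj₁ (refl , 0<-D)) v<0 = Small-map
    (λ ε _ (lt , 0<-y) → <-by (*-pos (⁻¹-neg D<0) 0<-y) (solve 2 (λ h y → (:0 :+ h :* y) :+ :- :0 := :- h :* :- y) refl (D ⁻¹) (root q t₀ g ε)) , lt)
    (Small-× (root-below q t₀ g (D ⁻¹) 0<1) (root-neg q t₀ g v<0))
    where
    D<0 : D < 0#
    D<0 = <-by 0<-D (+-identityˡ (- D))
  outward-inside q t₀ g {D = D} (inj₂ (refl , -D<0)) v<0 = Small-map
    (λ ε _ (lt , 0<-y) → lt , <-by (*-pos (⁻¹-pos 0<D) 0<-y) (solve 2 (λ h y → :1 :+ :- (:1 :+ h :* y) := h :* :- y) refl (D ⁻¹) (root q t₀ g ε)))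
    (Small-× (root-above q t₀ g (D ⁻¹) 0<1) (root-neg q t₀ g v<0))
    where
    0<D : 0# < D
    0<D = subst (0# <_) (solve 1 (λ d → :- :- d := d) refl D) (neg-pos -D<0)

  -- The segment leaves its tip towards negative ordinates, so no point of it has an ordinate above
  -- 0.
  outward-misses : ∀ {ρ₀ D ρ} → Inward ρ₀ (- D) → 0# ≤ ρ → ρ ≤ 1# → ¬ 0# < (ρ + - ρ₀) * D
  outward-misses {D = D} {ρ} (inj₁ (refl , 0<-D)) (inj₁ 0<ρ) _ pos =
    <-asym pos (<-by (*-pos 0<ρ 0<-D) (solve 2 (λ r d → :0 :+ :- ((r :+ :- :0) :* d) := r :* :- d) refl ρ D))
  outward-misses {D = D} (inj₁ (refl , _)) (inj₂ refl) _ pos =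
    <-irrefl (sym (solve 1 (λ d → (:0 :+ :- :0) :* d := :0) refl D)) pos
  outward-misses {D = D} {ρ} (inj₂ (refl , -D<0)) _ (inj₁ ρ<1) pos =
    <-asym pos (<-by (*-pos (0<diff ρ<1) (neg-pos -D<0)) (solve 2 (λ r d → :0 :+ :- ((r :+ :- :1) :* d) := (:1 :+ :- r) :* :- :- d) refl ρ D))
  outward-misses {D = D} (inj₂ (refl , _)) _ (inj₂ refl) pos =
    <-irrefl (sym (solve 1 (λ d → (:1 :+ :- :1) :* d := :0) refl D)) pos

  module GraphPieces (O e e₂ : Point) (det≢0 : det (e ⊖ O) e₂ ≢ 0#) where
    open Frame O e e₂ det≢0

    graphPiece : Kind → Carrier → Affine → Carrier → Carrier → Piece
    graphPiece k ε q t₁ t₂ = piece k (graph ε q t₁) (graph ε q t₂)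

    graph-crosses-graph : ∀ {k k′ ε q q′ t₁ t₂ t₁′ t₂′} t → 0# < ε → slope q ≢ slope q′ → value q t ≡ value q′ t →
      Between k t₁ t₂ t → Between k′ t₁′ t₂′ t → Crossing (graphPiece k ε q t₁ t₂) (graphPiece k′ ε q′ t₁′ t₂′)
    graph-crosses-graph {k} {k′} {t₁ = t₁} {t₂} {t₁′} {t₂′} t 0<ε s≢s′ eq b b′ =
      parameter t₁ t₂ t , parameter t₁′ t₂′ t , between⇒inside k b , between⇒inside k′ b′ ,
      hit-graph 0<ε (between⇒≢ k b) (between⇒≢ k′ b′) s≢s′ eq (at-parameter t (between⇒≢ k b)) (at-parameter t (between⇒≢ k′ b′))

    root-hit : ∀ {a b t₀ ρ₀ g D ε q t₁ t₂ τ} → Transversal a b t₀ ρ₀ g D → t₁ ≢ t₂ → 0# < denominator q g ε →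
      t₁ + τ * (t₂ + - t₁) ≡ t₀ + g * root q t₀ g ε → Hit (graph ε q t₁) (graph ε q t₂) a b τ (ρ₀ + D ⁻¹ * root q t₀ g ε)
    root-hit {t₀ = t₀} {ρ₀} {g} {D} {ε} {q} T t₁≢t₂ 0<d τ≡ =
      hit-transversal T t₁≢t₂ (0<x⇒x≢0 0<d) (root-fixed q t₀ g ε 0<d) τ≡ (begin
        (ρ₀ + D ⁻¹ * y + - ρ₀) * D     ≡⟨ solve 4 (λ r h y d → ((r :+ h :* y) :+ :- r) :* d := (y :* h) :* d) refl ρ₀ (D ⁻¹) y D ⟩
        y / D * D                      ≡⟨ /-* y (Transversal.D≢0 T) ⟩
        y                              ∎)
      where
      open ≡-Reasoning
      y = root q t₀ g ε

    -- The last hypothesis has different sources: `inside-stable` for a crossing in the interior of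
    -- `P`, and arguments about signs for one near a tip.
    graph-crosses-transversal : ∀ P {t₀ ρ₀ g D k q t₁ t₂} → Transversal (src P) (tgt P) t₀ ρ₀ g D → Between k t₁ t₂ t₀ →
      Small (λ ε → Inside (kind P) (ρ₀ + D ⁻¹ * root q t₀ g ε)) → Small (λ ε → Crossing (graphPiece k ε q t₁ t₂) P)
    graph-crosses-transversal P {t₀} {ρ₀} {g} {D} {k} {q} {t₁} {t₂} T b inside = Small-map
      (λ ε _ (b′ , i , 0<d) → parameter t₁ t₂ (t₀ + g * root q t₀ g ε) , _ , between⇒inside k b′ , i ,
        root-hit T (between⇒≢ k b′) 0<d (at-parameter _ (between⇒≢ k b′)))
      (Small-× (between-stable q t₀ g k b) (Small-× inside (denominator-pos q g)))

-- Attaching a vertex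

module Configurations (R : RealField) where
  open RealField R
  open Geometry R
  open OrderedField R
  open Lines R
  open Perturbation R

  +-pos-nonneg : ∀ {x y} → 0# < x → 0# ≤ y → 0# < x + y
  +-pos-nonneg 0<x (inj₁ 0<y) = +-pos 0<x 0<y
  +-pos-nonneg 0<x (inj₂ refl) = subst (0# <_) (sym (+-identityʳ _)) 0<x

  *-nonneg : ∀ {x y} → 0# < x → 0# ≤ y → 0# ≤ x * y
  *-nonneg 0<x (inj₁ 0<y) = inj₁ (*-pos 0<x 0<y)
  *-nonneg 0<x (inj₂ refl) = inj₂ (sym (zeroʳ _))

  -- The zero is `α / (- β)`. The function decreases, so a negative value at `c` puts the zero
  -- before `c`.
  affine-zero : ∀ {α β} → 0# < α → β < 0# → ∃ λ t → 0# < t × value (α , β) t ≡ 0# × (∀ c → value (α , β) c < 0# → t < c)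
  affine-zero {α} {β} 0<α β<0 = t , /-pos 0<α 0<-β ,
      trans (solve 3 (λ a b t → a :+ b :* t := a :+ :- (t :* :- b)) refl α β t) (trans (cong (λ z → α + - z) tβ≡α) (-‿inverseʳ α)) ,
      λ c v<0 → *-cancelʳ-< 0<-β (<-by (neg-pos v<0) (trans (cong (λ z → c * - β + - z) tβ≡α) (solve 3 (λ a b c → c :* :- b :+ :- a := :- (a :+ b :* c)) refl α β c)))
    where
    0<-β = neg-pos β<0
    t = α / (- β)
    tβ≡α : t * - β ≡ α
    tβ≡α = /-* α (0<x⇒x≢0 0<-β)

  *-cancel-neg : ∀ {x y} → 0# < y → 0# < - (x * y) → x < 0#
  *-cancel-neg {x} {y} 0<y lt = <-by (*-cancel-pos 0<y (subst (0# <_) (solve 2 (λ x y → :- (x :* y) := (:0 :+ :- x) :* y) refl x y) lt)) refl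

  -- The new segment lies on the graph of ε ℓ and ends at abscissa M; the new rays lie on the graphs of ε m
  -- and ε k.  The three lines are arranged so that m meets ℓ at M and k meets ℓ at c, while k vanishes
  -- at 1 and the sign of m at 1 is governed by φ.
  module Configuration (J : Carrier) (0<J : 0# < J) (φ : Carrier) (0≤φ : 0# ≤ φ) (0≤1-φ : 0# ≤ 1# + - φ) where

    -- `J` will exceed the abscissae of all earlier crossings with the axis, hence so will `c` and
    -- `M`. In factored form `ℓ` is `2 (1 + J) (2 - t)` and `k` is `2 J (1 - t)`. As `M - 1` is
    -- `3 (1 + J)`, the number `value m 1# * M` has the factor `1 + J`, and the other factor is
    -- `3 φ - 1`, free of `J`.
    c M p : Carrier
    c = fromℕ 2 + J
    M = fromℕ 4 + fromℕ 3 * J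
    p = 1# + fromℕ 2 * J + φ

    ℓ k m : Affine
    ℓ = fromℕ 4 * (1# + J) , - (fromℕ 2 * (1# + J))
    k = fromℕ 2 * J , - (fromℕ 2 * J)
    m = p , (value ℓ M + - p) / M

    private
      :ℓ₀ :ℓ₁ :c :M :2J : ∀ {n} → Polynomial n → Polynomial n
      :c J  = :# 2 :+ J
      :M J  = :# 4 :+ :# 3 :* J
      :ℓ₀ J = :# 4 :* (:1 :+ J)
      :ℓ₁ J = :- (:# 2 :* (:1 :+ J))
      :2J J = :# 2 :* J

      :p :B : ∀ {n} → Polynomial n → Polynomial n → Polynomial n
      :p J φ = :1 :+ :# 2 :* J :+ φ
      :B J φ = (:ℓ₀ J :+ :ℓ₁ J :* :M J) :+ :- :p J φ

    0<1+J : 0# < 1# + J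
    0<1+J = +-pos 0<1 0<J

    0<2J : 0# < fromℕ 2 * J
    0<2J = *-pos (fromℕ-pos 1) 0<J

    0<M : 0# < M
    0<M = +-pos (fromℕ-pos 3) (*-pos (fromℕ-pos 2) 0<J)

    0<c : 0# < c
    0<c = +-pos (fromℕ-pos 1) 0<J

    1<c : 1# < c
    1<c = <-by 0<1+J (solve 1 (λ J → :c J :+ :- :1 := :1 :+ J) refl J)

    c<M : c < M
    c<M = <-by (+-pos (fromℕ-pos 1) 0<2J) (solve 1 (λ J → :M J :+ :- :c J := :# 2 :+ :2J J) refl J)

    2<c : fromℕ 2 < c
    2<c = <-by 0<J (solve 1 (λ J → :c J :+ :- :# 2 := J) refl J)

    J<c : J < c
    J<c = <-by (fromℕ-pos 1) (solve 1 (λ J → :c J :+ :- J := :# 2) refl J)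

    0<p : 0# < p
    0<p = +-pos-nonneg (+-pos 0<1 0<2J) 0≤φ

    -- Clears the denominator: claims about the slope of `m` are multiplied by `M` and so become
    -- polynomial in `J` and `φ`.
    slope-m : slope m * M ≡ value ℓ M + - p
    slope-m = /-* _ (0<x⇒x≢0 0<M)

    m≡ℓ-at-M : value m M ≡ value ℓ M
    m≡ℓ-at-M = trans (cong (p +_) slope-m) (solve 2 (λ p v → p :+ (v :+ :- p) := v) refl p (value ℓ M))

    k≡ℓ-at-c : value k c ≡ value ℓ c
    k≡ℓ-at-c = solve 1 (λ J → :2J J :+ :- :2J J :* :c J := :ℓ₀ J :+ :ℓ₁ J :* :c J) refl J

    k-at-1 : value k 1# ≡ 0#
    k-at-1 = solve 1 (λ J → :2J J :+ :- :2J J :* :1 := :0) refl J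

    ℓ-at-2 : value ℓ (fromℕ 2) ≡ 0#
    ℓ-at-2 = solve 1 (λ J → :ℓ₀ J :+ :ℓ₁ J :* :# 2 := :0) refl J

    ℓ-at-1 : 0# < value ℓ 1#
    ℓ-at-1 = subst (0# <_) (solve 1 (λ J → :# 2 :* (:1 :+ J) := :ℓ₀ J :+ :ℓ₁ J :* :1) refl J) (*-pos (fromℕ-pos 1) 0<1+J)

    m-at-1 : value m 1# * M ≡ (1# + J) * (fromℕ 3 * φ + - 1#)
    m-at-1 = begin
      (p + slope m * 1#) * M               ≡⟨ solve 3 (λ p s M → (p :+ s :* :1) :* M := p :* M :+ s :* M) refl p (slope m) M ⟩
      p * M + slope m * M                  ≡⟨ cong (p * M +_) slope-m ⟩
      p * M + (value ℓ M + - p)            ≡⟨ solve 2 (λ J φ → :p J φ :* :M J :+ :B J φ := (:1 :+ J) :* (:# 3 :* φ :+ :- :1)) refl J φ ⟩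
      (1# + J) * (fromℕ 3 * φ + - 1#)      ∎
      where open ≡-Reasoning

    slope-m<0 : slope m < 0#
    slope-m<0 = *-cancel-neg 0<M (subst (0# <_)
      (trans (solve 2 (λ J φ → ((:1 :+ J) :* (:# 5 :+ :# 6 :* J) :+ J) :+ φ := :- :B J φ) refl J φ) (cong -_ (sym slope-m)))
      (+-pos-nonneg (+-pos (*-pos 0<1+J (+-pos (fromℕ-pos 4) (*-pos (fromℕ-pos 5) 0<J))) 0<J) 0≤φ))

    -- The lines agree at `M`. Equal slopes would make them agree at 0 as well, where `ℓ` exceeds
    -- `m` by `2 (1 + J) + (1 - φ)`.
    m≢ℓ : slope m ≢ slope ℓ
    m≢ℓ eq = 0<x⇒x≢0 (+-pos-nonneg (*-pos (fromℕ-pos 1) 0<1+J) 0≤1-φ) (begin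
      fromℕ 2 * (1# + J) + (1# + - φ)            ≡⟨ solve 2 (λ J φ → :# 2 :* (:1 :+ J) :+ (:1 :+ :- φ) := :B J φ :+ :- (:ℓ₁ J :* :M J)) refl J φ ⟩
      (value ℓ M + - p) + - (slope ℓ * M)        ≡⟨ cong (_+ - (slope ℓ * M)) (trans (sym slope-m) (cong (_* M) eq)) ⟩
      slope ℓ * M + - (slope ℓ * M)              ≡⟨ -‿inverseʳ _ ⟩
      0#                                         ∎)
      where open ≡-Reasoning

    k≢ℓ : slope k ≢ slope ℓ
    k≢ℓ eq = 0<x⇒x≢0 (fromℕ-pos 1) (trans
      (solve 1 (λ J → :# 2 := :- :2J J :+ :- :ℓ₁ J) refl J)
      (trans (cong (_+ - slope ℓ) eq) (-‿inverseʳ (slope ℓ))))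

    ℓ≢0 : slope ℓ ≢ 0#
    ℓ≢0 eq = 0<x⇒x≢0 (*-pos (fromℕ-pos 1) 0<1+J) (trans (solve 1 (λ x → x := :- :- x) refl _) (trans (cong -_ eq) -0#≈0#))

    k≢0 : slope k ≢ 0#
    k≢0 eq = 0<x⇒x≢0 0<2J (trans (solve 1 (λ x → x := :- :- x) refl _) (trans (cong -_ eq) -0#≈0#))

    -- For the crossing with the axis itself, which is one of the earlier rays.
    zero-of-m : ∃ λ t → 0# < t × value m t ≡ 0#
    zero-of-m = let t , 0<t , eq , _ = affine-zero 0<p slope-m<0 in t , 0<t , eq

    -- The difference of the two functions is `α + β t`; it is `1 + φ` at 0 and negative at `c`. The
    -- two new rays will cross here, one running right from 0 and the other left from `c`.
    m-meets-k : slope m ≢ slope k × ∃ λ t → 0# < t × t < c × value m t ≡ value k t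
    m-meets-k = (λ eq → <⇒≢ β<0 (trans (cong (_+ fromℕ 2 * J) eq) (solve 1 (λ x → :- x :+ x := :0) refl _))) ,
        t , 0<t , below c α+βc<0 , x-y≡0 (trans (solve 4 (λ p s j t → (p :+ s :* t) :+ :- (j :+ :- j :* t) := (p :+ :- j) :+ (s :+ j) :* t) refl p (slope m) (fromℕ 2 * J) t) eq)
      where
      open ≡-Reasoning
      α β : Carrier
      α = p + - (fromℕ 2 * J)
      β = slope m + fromℕ 2 * J
      0<α : 0# < α
      0<α = subst (0# <_) (solve 2 (λ J φ → :1 :+ φ := :p J φ :+ :- :2J J) refl J φ) (+-pos-nonneg 0<1 0≤φ)
      βM : β * M ≡ - (fromℕ 5 + fromℕ 4 * J + φ)
      βM = begin
        (slope m + fromℕ 2 * J) * M                    ≡⟨ distribʳ M _ _ ⟩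
        slope m * M + fromℕ 2 * J * M                  ≡⟨ cong (_+ fromℕ 2 * J * M) slope-m ⟩
        (value ℓ M + - p) + fromℕ 2 * J * M            ≡⟨ solve 2 (λ J φ → :B J φ :+ :2J J :* :M J := :- (:# 5 :+ :# 4 :* J :+ φ)) refl J φ ⟩
        - (fromℕ 5 + fromℕ 4 * J + φ)                  ∎
      β<0 : β < 0#
      β<0 = *-cancel-neg 0<M (subst (0# <_) (trans (solve 1 (λ x → x := :- :- x) refl _) (cong -_ (sym βM)))
        (+-pos-nonneg (+-pos (fromℕ-pos 4) (*-pos (fromℕ-pos 3) 0<J)) 0≤φ))
      α+βc<0 : value (α , β) c < 0#
      α+βc<0 = *-cancel-neg 0<M (subst (0# <_) (sym (begin
          - ((α + β * c) * M)                                          ≡⟨ solve 4 (λ a b c M → :- ((a :+ b :* c) :* M) := :- (a :* M :+ (b :* M) :* c)) refl α β c M ⟩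
          - (α * M + β * M * c)                                        ≡⟨ cong (λ z → - (α * M + z * c)) βM ⟩
          - (α * M + - (fromℕ 5 + fromℕ 4 * J + φ) * c)                ≡⟨ solve 2 (λ J φ → :- ((:p J φ :+ :- :2J J) :* :M J :+ :- (:# 5 :+ :# 4 :* J :+ φ) :* :c J) := :# 4 :* ((:1 :+ J) :* (:1 :+ J)) :+ (:# 2 :* (:1 :+ J)) :* (:1 :+ :- φ)) refl J φ ⟩
          fromℕ 4 * ((1# + J) * (1# + J)) + fromℕ 2 * (1# + J) * (1# + - φ) ∎))
        (+-pos-nonneg (*-pos (fromℕ-pos 3) (*-pos 0<1+J 0<1+J)) (*-nonneg (*-pos (fromℕ-pos 1) 0<1+J) 0≤1-φ)))
      zero-αβ = affine-zero 0<α β<0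
      t = proj₁ zero-αβ
      0<t = proj₁ (proj₂ zero-αβ)
      eq = proj₁ (proj₂ (proj₂ zero-αβ))
      below = proj₂ (proj₂ (proj₂ zero-αβ))

-- The new segment and its two rays.

module Attaching (R : RealField) where
  open RealField R
  open Geometry R
  open OrderedField R
  open Lines R
  open Perturbation R
  open Configurations R

  MeetsIf : Bool → Segment → Segment → Set
  MeetsIf true  s t = Meets s t
  MeetsIf false s t = ¬ Meets s t

  Joins : Ray → Segment → Segment → Set
  Joins r s t = Starts (rayPiece r) (segmentPiece s) (segmentPiece t) ⊎ Starts (rayPiece r) (segmentPiece t) (segmentPiece s)

  -- `Ps` will hold all earlier pieces except the segments `X` and `Y`, including the ray of the
  -- edge to which the vertex is attached. The interface treats `X` and `Y` alike although the
  -- construction does not.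
  record Extension (X Y : Segment) (βX βY : Bool) (Ps : List Piece) : Set where
    field
      V       : Segment
      rX rY   : Ray
      V-Ps    : All (Crossing (segmentPiece V)) Ps
      rX-Ps   : All (Crossing (rayPiece rX)) Ps
      rY-Ps   : All (Crossing (rayPiece rY)) Ps
      rX-Y    : Crossing (rayPiece rX) (segmentPiece Y)
      rY-X    : Crossing (rayPiece rY) (segmentPiece X)
      rX-rY   : Crossing (rayPiece rX) (rayPiece rY)
      joinsX  : Joins rX V X
      joinsY  : Joins rY V Y
      V-X     : MeetsIf βX V X
      V-Y     : MeetsIf βY V Y

  swap-extension : ∀ {X Y βX βY Ps} → Extension X Y βX βY Ps → Extension Y X βY βX Ps
  swap-extension ext = record
    { V = V ; rX = rY ; rY = rX ; V-Ps = V-Ps ; rX-Ps = rY-Ps ; rY-Ps = rX-Ps ; rX-Y = rY-X ; rY-X = rX-Y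
    ; rX-rY = Crossing-sym rX-rY ; joinsX = joinsY ; joinsY = joinsX ; V-X = V-Y ; V-Y = V-X }
    where open Extension ext

  -- The new segment always passes the tip of `Y` at positive ordinate. Whether it meets `Y` is
  -- controlled by the side on which `Y` lies, that is, by the orientation of the frame.
  Side : Bool → Carrier → Carrier → Set
  Side true  ρ D = Inward ρ D
  Side false ρ D = Inward ρ (- D)

  -- The ray `rX` has to cross `Y` in both cases, so it must pass the tip on the side of `Y`; `φ`
  -- shifts `m` accordingly.
  φ : Bool → Carrier
  φ true  = 1#
  φ false = 0#

  0≤φ : ∀ β → 0# ≤ φ β
  0≤φ true  = inj₁ 0<1
  0≤φ false = inj₂ refl

  0≤1-φ : ∀ β → 0# ≤ 1# + - φ β
  0≤1-φ true  = inj₂ (sym (-‿inverseʳ 1#))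
  0≤1-φ false = inj₁ (subst (0# <_) (solve 0 (:1 := :1 :+ :- :0) refl) 0<1)

  -- `X` lies at abscissa 0. The new segment begins either behind it, or after it but before the
  -- crossings of the pieces in `Ps` with the axis.
  leftEnd : Bool → Carrier → Carrier
  leftEnd true  τ = - 1#
  leftEnd false τ = τ

  -1<0 : - 1# < 0#
  -1<0 = <-by 0<1 (solve 0 (:0 :+ :- :- :1 := :1) refl)

  leftEnd≤ : ∀ β {τ} → 0# < τ → leftEnd β τ ≤ τ
  leftEnd≤ true  0<τ = inj₁ (<-trans -1<0 0<τ)
  leftEnd≤ false _   = inj₂ refl

  -- `0# < t₀` is kept apart from `lo < t₀` because `lo` is negative when the new segment begins
  -- behind `X`.
  Bounded : Point → Point → Carrier → Carrier → Piece → Set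
  Bounded O e lo hi P = P ≡ piece ray O e ⊎
    ∃ λ t₀ → ∃ λ ρ₀ → lo < t₀ × 0# < t₀ × t₀ < hi × Inside (kind P) ρ₀ × Hit O e (src P) (tgt P) t₀ ρ₀

  -- One small number controls the crossings on both sides: it bounds them from below, and its
  -- reciprocal bounds them from above.
  bounded : ∀ {O e P} → P ≡ piece ray O e ⊎ Crossing (piece ray O e) P → Small (λ τ → Bounded O e τ (τ ⁻¹) P)
  bounded (inj₁ eq) = 1# , 0<1 , λ _ _ _ → inj₁ eq
  bounded (inj₂ (t₀ , ρ₀ , 0<t₀ , iρ₀ , h)) = Small-map {P = λ τ → 1# * τ < t₀ × t₀ * τ < 1#}
    (λ τ 0<τ (lt , lt′) → inj₂ (t₀ , ρ₀ , subst (_< t₀) (*-identityˡ τ) lt , 0<t₀ ,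
       *-cancelʳ-< 0<τ (subst (t₀ * τ <_) (sym (trans (*-comm _ _) (⁻¹-inverse τ (0<x⇒x≢0 0<τ)))) lt′) , iρ₀ , h))
    (Small-× (small-multiple 1# 0<t₀) (small-multiple t₀ 0<1))

  bounded-weaken : ∀ {O e lo lo′ hi P} → lo′ ≤ lo → Bounded O e lo hi P → Bounded O e lo′ hi P
  bounded-weaken _  (inj₁ eq) = inj₁ eq
  bounded-weaken le (inj₂ (t₀ , ρ₀ , lt , rest)) = inj₂ (t₀ , ρ₀ , ≤-<-trans le lt , rest)

  module InFrame (O e e₂ : Point) (det≢0 : det (e ⊖ O) e₂ ≢ 0#) where
    open Frame O e e₂ det≢0
    open GraphPieces O e e₂ det≢0

    -- For every `ε` the axis is on the graph of the zero function, so crossings with it become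
    -- crossings of two graphs.
    axis : ∀ ε → piece ray O e ≡ graphPiece ray ε (0# , 0#) 0# 1#
    axis ε = cong₂ (piece ray) (cong₂ _,_ (start (proj₁ O) (proj₁ e) (proj₁ e₂)) (start (proj₂ O) (proj₂ e) (proj₂ e₂)))
                               (cong₂ _,_ (end (proj₁ O) (proj₁ e) (proj₁ e₂)) (end (proj₂ O) (proj₂ e) (proj₂ e₂)))
      where
      start : ∀ o x d → o ≡ o + (0# * (x + - o) + (ε * (0# + 0# * 0#)) * d)
      start = solve 4 (λ e o x d → o := o :+ (:0 :* (x :+ :- o) :+ (e :* (:0 :+ :0 :* :0)) :* d)) refl ε
      end : ∀ o x d → x ≡ o + (1# * (x + - o) + (ε * (0# + 0# * 1#)) * d)
      end = solve 4 (λ e o x d → x := o :+ (:1 :* (x :+ :- o) :+ (e :* (:0 :+ :0 :* :1)) :* d)) refl ε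

    graph-crosses-axis : ∀ {k q t₁ t₂} t ε → 0# < ε → 0# < t → slope q ≢ 0# → value q t ≡ 0# → Between k t₁ t₂ t →
      Crossing (graphPiece k ε q t₁ t₂) (piece ray O e)
    graph-crosses-axis {k} {q} {t₁} {t₂} t ε 0<ε 0<t s≢0 v≡0 b = subst (Crossing (graphPiece k ε q t₁ t₂)) (sym (axis ε))
      (graph-crosses-graph t 0<ε s≢0 (trans v≡0 (solve 1 (λ t → :0 := :0 :+ :0 :* t) refl t)) b (inj₁ (0<1 , 0<t)))

    -- The axis itself is crossed where `q` vanishes; any other piece is crossed near its own
    -- crossing with the axis.
    graph-crosses-bounded : ∀ {k q t₁ t₂ lo hi P} t → 0# < t → slope q ≢ 0# → value q t ≡ 0# → Between k t₁ t₂ t →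
      (∀ t₀ → lo < t₀ → 0# < t₀ → t₀ < hi → Between k t₁ t₂ t₀) → Bounded O e lo hi P →
      Small (λ ε → Crossing (graphPiece k ε q t₁ t₂) P)
    graph-crosses-bounded t 0<t s≢0 v≡0 b _ (inj₁ refl) = 1# , 0<1 , λ ε 0<ε _ → graph-crosses-axis t ε 0<ε 0<t s≢0 v≡0 b
    graph-crosses-bounded {q = q} {P = P} _ _ _ _ _ between (inj₂ (t₀ , ρ₀ , lo<t₀ , 0<t₀ , t₀<hi , i , h)) =
      let g , D , T = hit⇒transversal h
      in graph-crosses-transversal P T (between t₀ lo<t₀ 0<t₀ t₀<hi) (inside-stable q t₀ g (kind P) (D ⁻¹) i)

    graph≢ : ∀ {ε q t₁ t₂} → t₁ ≢ t₂ → graph ε q t₁ ≢ graph ε q t₂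
    graph≢ t₁≢t₂ eq = t₁≢t₂ (proj₁ (at-injective eq))

    -- `X` has inverse slope 0, so its line is exactly `t = 0`. The requirements hold for all small
    -- `ε`, and a common `ε` is chosen at the end.
    extension : ∀ (X Y : Segment) {ρX DX ρY gY DY} βX βY {τ Ps} →
      Transversal (Segment.a X) (Segment.b X) 0# ρX 0# DX → Inside segment ρX →
      Transversal (Segment.a Y) (Segment.b Y) 1# ρY gY DY → Tip ρY → Side βY ρY DY →
      0# < τ → τ < 1# → All (Bounded O e τ (τ ⁻¹)) Ps → Extension X Y βX βY Ps
    extension X@(seg Xa Xb _) Y@(seg Ya Yb _) {ρX} {DX} {ρY} {gY} {DY} βX βY {τ} {Ps} TX iX TY tipY side 0<τ τ<1 Ps-bounded = record
      { V = V ; rX = rX ; rY = rY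
      ; V-Ps = proj₁ chosen ; rX-Ps = proj₁ (proj₂ chosen) ; rY-Ps = proj₁ (proj₂ (proj₂ chosen))
      ; rX-Y = proj₁ (proj₂ (proj₂ (proj₂ chosen)))
      ; rY-X = proj₁ (proj₂ (proj₂ (proj₂ (proj₂ chosen))))
      ; rX-rY = graph-crosses-graph tₘₖ 0<ε (proj₁ m-meets-k) mt≡kt (inj₁ (0<M , 0<tₘₖ)) (inj₂ (1<c , tₘₖ<c))
      ; joinsX = inj₂ (proj₁ (proj₂ (proj₂ (proj₂ (proj₂ (proj₂ chosen))))))
      ; joinsY = inj₁ (proj₁ (proj₂ (proj₂ (proj₂ (proj₂ (proj₂ (proj₂ chosen)))))))
      ; V-X = proj₁ (proj₂ (proj₂ (proj₂ (proj₂ (proj₂ (proj₂ (proj₂ chosen)))))))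
      ; V-Y = proj₂ (proj₂ (proj₂ (proj₂ (proj₂ (proj₂ (proj₂ (proj₂ chosen)))))))
      }
      where
      J = τ ⁻¹
      open Configuration J (⁻¹-pos 0<τ) (φ βY) (0≤φ βY) (0≤1-φ βY)

      tₘₖ = proj₁ (proj₂ m-meets-k)
      0<tₘₖ = proj₁ (proj₂ (proj₂ m-meets-k))
      tₘₖ<c = proj₁ (proj₂ (proj₂ (proj₂ m-meets-k)))
      mt≡kt = proj₂ (proj₂ (proj₂ (proj₂ m-meets-k)))

      lo = leftEnd βX τ
      lo<1 : lo < 1#
      lo<1 = ≤-<-trans (leftEnd≤ βX 0<τ) τ<1
      lo<c : lo < c
      lo<c = <-trans lo<1 1<c
      lo<M : lo < M
      lo<M = <-trans lo<c c<M
      1<2 : 1# < fromℕ 2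
      1<2 = <-by 0<1 (solve 0 (:# 2 :+ :- :1 := :1) refl)

      module _ (ε : Carrier) where
        Vₑ rXₑ rYₑ : Piece
        -- The ray on `m` leaves `X` and passes through the right end of the segment. The ray on `k`
        -- leaves the segment at `c` and runs left through abscissa 1, where `Y` has its tip.
        Vₑ  = graphPiece segment ε ℓ lo M
        rXₑ = graphPiece ray ε m 0# M
        rYₑ = graphPiece ray ε k c 1#
        Vₛ : Segment
        Vₛ = seg (src Vₑ) (tgt Vₑ) (graph≢ (<⇒≢ lo<M))

      Ps-bounded′ : All (Bounded O e lo J) Ps
      Ps-bounded′ = All.map (bounded-weaken (leftEnd≤ βX 0<τ)) Ps-bounded

      crossV : Small (λ ε → All (Crossing (Vₑ ε)) Ps)
      crossV = Small-All (All.map (graph-crosses-bounded (fromℕ 2) (fromℕ-pos 1) ℓ≢0 ℓ-at-2 (<-trans lo<1 1<2 , <-trans 2<c c<M)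
        (λ t₀ lo<t₀ _ t₀<J → lo<t₀ , <-trans t₀<J (<-trans J<c c<M))) Ps-bounded′)

      crossX : Small (λ ε → All (Crossing (rXₑ ε)) Ps)
      crossX = let t , 0<t , eq = zero-of-m in Small-All (All.map (graph-crosses-bounded t 0<t (<⇒≢ slope-m<0) eq (inj₁ (0<M , 0<t))
        (λ t₀ _ 0<t₀ _ → inj₁ (0<M , 0<t₀))) Ps-bounded′)

      crossY : Small (λ ε → All (Crossing (rYₑ ε)) Ps)
      crossY = Small-All (All.map (graph-crosses-bounded 1# 0<1 k≢0 k-at-1 (inj₂ (1<c , 1<c))
        (λ t₀ _ _ t₀<J → inj₂ (1<c , <-trans t₀<J J<c))) Ps-bounded′)

      -- By the equation, `value m 1#` has the sign of `3 φ - 1`, which is 2 or -1: positive exactly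
      -- when `Y` lies on the positive side.
      m-side : ∀ β → Side β ρY DY → value m 1# * M ≡ (1# + J) * (fromℕ 3 * φ β + - 1#) →
        Small (λ ε → Inside segment (ρY + DY ⁻¹ * root m 1# gY ε))
      m-side true inward eq = inward-inside m 1# gY inward (*-cancel-pos 0<M (subst (0# <_) (sym eq)
        (*-pos 0<1+J (subst (0# <_) (solve 0 (:# 2 := :# 3 :* :1 :+ :- :1) refl) (fromℕ-pos 1)))))
      m-side false outward eq = outward-inside m 1# gY outward (*-cancel-neg 0<M (subst (0# <_)
        (trans (solve 1 (λ x → x := :- (x :* (:# 3 :* :0 :+ :- :1))) refl (1# + J)) (cong -_ (sym eq))) 0<1+J))

      crossXY : Small (λ ε → Crossing (rXₑ ε) (segmentPiece Y))
      crossXY = graph-crosses-transversal (segmentPiece Y) TY (inj₁ (0<M , 0<1)) (m-side βY side m-at-1)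

      crossYX : Small (λ ε → Crossing (rYₑ ε) (segmentPiece X))
      -- Seen from `c`, abscissa 0 lies beyond 1, so the ray reaches `X` after the tip of `Y`.
      crossYX = graph-crosses-transversal (segmentPiece X) TX (inj₂ (1<c , 0<c)) (inside-stable k 0# 0# segment (DX ⁻¹) iX)

      start-rX : Small (λ ε → Starts (rXₑ ε) (segmentPiece X) (Vₑ ε))
      start-rX = Small-map
        (λ ε 0<ε (i , 0<d) →
          (_ , i , root-hit TX (<⇒≢ 0<M) 0<d (trans (at-0 0# M) (solve 1 (λ y → :0 := :0 :+ :0 :* y) refl (root m 0# 0# ε)))) ,
          (1# , inj₂ refl , hit-graph 0<ε (<⇒≢ 0<M) (<⇒≢ lo<M) m≢ℓ m≡ℓ-at-M (at-1 0# M) (at-1 lo M)))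
        (Small-× (inside-stable m 0# 0# segment (DX ⁻¹) iX) (denominator-pos m 0#))

      -- The ray on `k` has to go through the tip of `Y` exactly and not only nearby. As `k`
      -- vanishes at 1, the fixed point is 0 and `Y` is hit at its unperturbed parameter `ρY`.
      k-fixed : ∀ ε → 0# ≡ ε * value k (1# + gY * 0#)
      k-fixed ε = sym (begin
        ε * value k (1# + gY * 0#)     ≡⟨ cong (λ z → ε * value k z) (solve 1 (λ g → :1 :+ g :* :0 := :1) refl gY) ⟩
        ε * value k 1#                 ≡⟨ cong (ε *_) k-at-1 ⟩
        ε * 0#                         ≡⟨ zeroʳ ε ⟩
        0#                             ∎)
        where open ≡-Reasoning

      start-rY-at : ∀ ε → 0# < ε → 0# < denominator k gY ε → Starts (rYₑ ε) (Vₑ ε) (segmentPiece Y)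
      start-rY-at ε 0<ε 0<d =
          (parameter lo M c , between⇒inside segment (lo<c , c<M) ,
            hit-graph 0<ε (>⇒≢ 1<c) (<⇒≢ lo<M) k≢ℓ k≡ℓ-at-c (at-0 c 1#) (at-parameter c (<⇒≢ lo<M))) ,
          (ρY , tipY , hit-transversal TY (>⇒≢ 1<c) (0<x⇒x≢0 0<d) (k-fixed ε)
            (trans (at-1 c 1#) (solve 1 (λ g → :1 := :1 :+ g :* :0) refl gY))
            (solve 2 (λ r d → (r :+ :- r) :* d := :0) refl ρY DY))
      k-denominator-pos : Small (λ ε → 0# < denominator k gY ε)
      k-denominator-pos = denominator-pos k gY

      start-rY : Small (λ ε → Starts (rYₑ ε) (Vₑ ε) (segmentPiece Y))
      start-rY = Small-map start-rY-at k-denominator-pos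

      meetX : ∀ β → lo ≡ leftEnd β τ → Small (λ ε → MeetsIf β (Vₛ ε) X)
      meetX true lo≡ = Small-map (λ ε _ → crossing⇒meets (Vₛ ε) X)
        (graph-crosses-transversal (segmentPiece X) TX (subst (_< 0#) (sym lo≡) -1<0 , 0<M) (inside-stable ℓ 0# 0# segment (DX ⁻¹) iX))
      -- All points of the segment have abscissa at least `τ`, which is positive, while `X` has
      -- abscissa 0. The bound 1 on `ε` is arbitrary.
      meetX false lo≡ = 1# , 0<1 , λ { ε _ _ (_ , (σ , 0≤σ , _ , eq) , (ρ , _ , _ , eq′)) →
        <⇒≢ (+-pos-nonneg (subst (0# <_) (sym lo≡) 0<τ) (subst (0# ≤_) (*-comm _ σ) (*-nonneg (0<diff lo<M) 0≤σ)))
          (sym (trans (proj₁ (at-injective (trans (sym (lin-graph ε ℓ lo M σ)) (trans (sym eq) (trans eq′ (Transversal.curve TX ρ))))))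
            (solve 1 (λ y → :0 :+ :0 :* y := :0) refl _))) }

      -- `ℓ` is positive at 1, so for small `ε` the two lines meet at positive ordinate. In the case
      -- `false`, `Y` has no point there, and the lines have no other common point.
      meetY : ∀ β → Side β ρY DY → Small (λ ε → MeetsIf β (Vₛ ε) Y)
      meetY true inward = Small-map (λ ε _ → crossing⇒meets (Vₛ ε) Y)
        (graph-crosses-transversal (segmentPiece Y) TY (lo<1 , <-trans 1<c c<M) (inward-inside ℓ 1# gY inward ℓ-at-1))
      meetY false outward = Small-map
        (λ { ε _ (0<d , 0<y) (_ , (σ , _ , _ , eq) , (ρ , 0≤ρ , ρ≤1 , eq′)) →
          outward-misses outward 0≤ρ ρ≤1 (subst (0# <_) (sym (begin
            (ρ + - ρY) * DY                                       ≡⟨ cong (λ z → (z + - ρY) * DY) (proj₂ (Hit.unique (root-hit TY (<⇒≢ lo<M) 0<d (at-parameter _ (<⇒≢ lo<M))) (trans (sym eq) eq′))) ⟩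
            (ρY + DY ⁻¹ * root ℓ 1# gY ε + - ρY) * DY             ≡⟨ solve 4 (λ r h y d → ((r :+ h :* y) :+ :- r) :* d := (y :* h) :* d) refl ρY (DY ⁻¹) (root ℓ 1# gY ε) DY ⟩
            root ℓ 1# gY ε / DY * DY                              ≡⟨ /-* _ (Transversal.D≢0 TY) ⟩
            root ℓ 1# gY ε                                        ∎)) 0<y) })
        (Small-× (denominator-pos ℓ gY) (root-pos ℓ 1# gY ℓ-at-1))
        where open ≡-Reasoning

      choice = Small-witness (Small-× crossV (Small-× crossX (Small-× crossY (Small-× crossXY (Small-× crossYX
                 (Small-× start-rX (Small-× start-rY (Small-× (meetX βX refl) (meetY βY side)))))))))
      ε = proj₁ choice
      0<ε = proj₁ (proj₂ choice)
      chosen = proj₂ (proj₂ choice)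
      V = Vₛ ε
      rX rY : Ray
      rX = ray (src (rXₑ ε)) (tgt (rXₑ ε)) (graph≢ (<⇒≢ 0<M))
      rY = ray (src (rYₑ ε)) (tgt (rYₑ ε)) (graph≢ (>⇒≢ 1<c))

  -- Choice of the frame.

  inward-or-outward : ∀ {ρ D} → Tip ρ → D ≢ 0# → Inward ρ D ⊎ Inward ρ (- D)
  inward-or-outward {ρ} {D} tip D≢0 with compare D 0# | tip
  ... | tri< D<0 _ _ | inj₁ ρ≡0 = inj₂ (inj₁ (ρ≡0 , neg-pos D<0))
  ... | tri< D<0 _ _ | inj₂ ρ≡1 = inj₁ (inj₂ (ρ≡1 , D<0))
  ... | tri≈ _ D≡0 _ | _        = ⊥-elim (D≢0 D≡0)
  ... | tri> _ _ 0<D | inj₁ ρ≡0 = inj₁ (inj₁ (ρ≡0 , 0<D))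
  ... | tri> _ _ 0<D | inj₂ ρ≡1 = inj₂ (inj₂ (ρ≡1 , <-by 0<D (solve 1 (λ d → :0 :+ :- :- d := d) refl D)))

  ⊝_ : Point → Point
  ⊝ (x , y) = - x , - y

  det-⊝ : ∀ u w → det u w ≢ 0# → det u (⊝ w) ≢ 0#
  det-⊝ (u₁ , u₂) (w₁ , w₂) det≢0 eq = det≢0 (trans
    (solve 4 (λ u₁ u₂ w₁ w₂ → u₁ :* w₂ :+ :- (u₂ :* w₁) := :- (u₁ :* :- w₂ :+ :- (u₂ :* :- w₁))) refl u₁ u₂ w₁ w₂)
    (trans (cong -_ eq) -0#≈0#))

  -- Reversing `e₂` exchanges the two sides of the axis, and with them `Inward ρ₀ D` and
  -- `Inward ρ₀ (- D)`.
  flip-transversal : ∀ {O e e₂ a b t₀ ρ₀ g D} (det≢0 : det (e ⊖ O) e₂ ≢ 0#) →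
    Frame.Transversal O e e₂ det≢0 a b t₀ ρ₀ g D → Frame.Transversal O e (⊝ e₂) (det-⊝ (e ⊖ O) e₂ det≢0) a b t₀ ρ₀ (- g) (- D)
  flip-transversal {O} {e} {e₂} {a} {b} {t₀} {ρ₀} {g} {D} det≢0 T = record
    { D≢0 = λ eq → D≢0 (trans (solve 1 (λ d → d := :- :- d) refl D) (trans (cong -_ eq) -0#≈0#))
    ; curve = λ ρ → trans (curve ρ) (cong₂ _,_ (component ρ (proj₁ O) (proj₁ (e ⊖ O)) (proj₁ e₂)) (component ρ (proj₂ O) (proj₂ (e ⊖ O)) (proj₂ e₂))) }
    where
    open Frame.Transversal T
    component : ∀ ρ o x y → o + ((t₀ + g * ((ρ + - ρ₀) * D)) * x + ((ρ + - ρ₀) * D) * y) ≡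
                            o + ((t₀ + - g * ((ρ + - ρ₀) * - D)) * x + ((ρ + - ρ₀) * - D) * - y)
    component ρ o x y = solve 7 (λ o x y t g w d → o :+ ((t :+ g :* (w :* d)) :* x :+ (w :* d) :* y) :=
      o :+ ((t :+ :- g :* (w :* :- d)) :* x :+ (w :* :- d) :* :- y)) refl o x y t₀ g (ρ + - ρ₀) D

  -- The second frame vector is the direction of `X`, which puts `X` on a line of constant abscissa.
  -- It is reversed when `Y` is not on the side that `βY` demands.
  extend : ∀ X Y r βX βY Ps → Starts (rayPiece r) (segmentPiece X) (segmentPiece Y) →
    All (λ P → P ≡ rayPiece r ⊎ Crossing (rayPiece r) P) Ps → Extension X Y βX βY Ps
  extend X@(seg Xa Xb _) Y@(seg Ya Yb _) (ray O e O≢e) βX βY Ps ((ρX , iX , hitX) , (ρY , tipY , hitY)) crossings =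
      orient βY refl (inward-or-outward tipY (Frame.Transversal.D≢0 TY))
    where
    det≢0 : det (e ⊖ O) (Xb ⊖ Xa) ≢ 0#
    det≢0 = hit⇒det≢0 O≢e hitX
    module F = Frame O e (Xb ⊖ Xa) det≢0
    TX : F.Transversal Xa Xb 0# ρX 0# 1#
    TX = record
      { D≢0 = λ eq → 0≢1 (sym eq)
      ; curve = λ ρ → cong₂ _,_ (component ρ (proj₁ (e ⊖ O)) (cong proj₁ O≡)) (component ρ (proj₂ (e ⊖ O)) (cong proj₂ O≡)) }
      where
      O≡ : O ≡ lin Xa Xb ρX
      O≡ = trans (sym (lin-0 O e)) (Hit.meet hitX)
      component : ∀ {o x y} ρ w → o ≡ x + ρX * (y + - x) →
        x + ρ * (y + - x) ≡ o + ((0# + 0# * ((ρ + - ρX) * 1#)) * w + ((ρ + - ρX) * 1#) * (y + - x))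
      component {o} {x} {y} ρ w eq = trans
        (solve 5 (λ r r₀ x v w → x :+ r :* v := (x :+ r₀ :* v) :+ ((:0 :+ :0 :* ((r :+ :- r₀) :* :1)) :* w :+ ((r :+ :- r₀) :* :1) :* v)) refl ρ ρX x (y + - x) w)
        (cong (_+ ((0# + 0# * ((ρ + - ρX) * 1#)) * w + ((ρ + - ρX) * 1#) * (y + - x))) (sym eq))
    gY = proj₁ (F.hit⇒transversal hitY)
    DY = proj₁ (proj₂ (F.hit⇒transversal hitY))
    TY : F.Transversal Ya Yb 1# ρY gY DY
    TY = proj₂ (proj₂ (F.hit⇒transversal hitY))
    module F⁻ = Frame O e (⊝ (Xb ⊖ Xa)) (det-⊝ (e ⊖ O) (Xb ⊖ Xa) det≢0)
    TX⁻ : F⁻.Transversal Xa Xb 0# ρX 0# (- 1#)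
    TX⁻ = subst (λ g → F⁻.Transversal Xa Xb 0# ρX g (- 1#)) -0#≈0# (flip-transversal det≢0 TX)
    TY⁻ : F⁻.Transversal Ya Yb 1# ρY (- gY) (- DY)
    TY⁻ = flip-transversal det≢0 TY
    choice = Small-witness (Small-× (Small-map (λ τ _ → subst (_< 1#) (*-identityˡ τ)) (small-multiple 1# 0<1)) (Small-All (All.map bounded crossings)))
    0<τ = proj₁ (proj₂ choice)
    τ<1 = proj₁ (proj₂ (proj₂ choice))
    Ps-bounded = proj₂ (proj₂ (proj₂ choice))
    in-frame : Side βY ρY DY → Extension X Y βX βY Ps
    in-frame side = InFrame.extension O e (Xb ⊖ Xa) det≢0 X Y βX βY TX iX TY tipY side 0<τ τ<1 Ps-bounded
    in-flipped-frame : Side βY ρY (- DY) → Extension X Y βX βY Ps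
    in-flipped-frame side = InFrame.extension O e (⊝ (Xb ⊖ Xa)) (det-⊝ (e ⊖ O) (Xb ⊖ Xa) det≢0) X Y βX βY TX⁻ iX TY⁻ tipY side 0<τ τ<1 Ps-bounded
    orient : ∀ β → β ≡ βY → Inward ρY DY ⊎ Inward ρY (- DY) → Extension X Y βX βY Ps
    orient true  refl (inj₁ inward)  = in-frame inward
    orient true  refl (inj₂ outward) = in-flipped-frame outward
    orient false refl (inj₁ inward)  = in-flipped-frame (subst (Inward ρY) (solve 1 (λ d → d := :- :- d) refl DY) inward)
    orient false refl (inj₂ outward) = in-frame outward

  abstract
    -- `extend` wants the ray to start in its first segment; otherwise the roles of `X` and `Y` are
    -- exchanged.
    extend-joined : ∀ X Y r βX βY Ps → Joins r X Y →
      All (λ P → P ≡ rayPiece r ⊎ Crossing (rayPiece r) P) Ps → Extension X Y βX βY Ps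
    extend-joined X Y r βX βY Ps (inj₁ starts) crossings = extend X Y r βX βY Ps starts crossings
    extend-joined X Y r βX βY Ps (inj₂ starts) crossings = swap-extension (extend Y X r βY βX Ps starts crossings)

-- Two-trees

allPairs-lookup : ∀ {A : Set} {_~_ : A → A → Set} → (∀ {x y} → x ~ y → y ~ x) →
  ∀ {xs x y} → AllPairs _~_ xs → x ∈ xs → y ∈ xs → x ≡ y ⊎ x ~ y
allPairs-lookup ~-sym (_ ∷ _)  (here refl) (here refl) = inj₁ refl
allPairs-lookup ~-sym (p ∷ _)  (here refl) (there y∈)  = inj₂ (All.lookup p y∈)
allPairs-lookup ~-sym (p ∷ _)  (there x∈)  (here refl) = inj₂ (~-sym (All.lookup p x∈))
allPairs-lookup ~-sym (_ ∷ ps) (there x∈)  (there y∈)  = allPairs-lookup ~-sym ps x∈ y∈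

builds-edge : ∀ {n} {vs : List (Fin n)} {es u w} → Builds vs es → (u , w) ∈ es → u ∈ vs × w ∈ vs × u ≢ w
builds-edge (base x≢y) (here refl) = here refl , there (here refl) , x≢y
builds-edge (step {x = x} {y} b xy v∉) e with adjacent xy
  where
  adjacent : Adj _ x y → x ∈ _ × y ∈ _
  adjacent (inj₁ xy∈) = let x∈ , y∈ , _ = builds-edge b xy∈ in x∈ , y∈
  adjacent (inj₂ yx∈) = let y∈ , x∈ , _ = builds-edge b yx∈ in x∈ , y∈
builds-edge (step b xy v∉) (here refl)         | x∈ , y∈ = here refl , there x∈ , λ { refl → v∉ x∈ }
builds-edge (step b xy v∉) (there (here refl)) | x∈ , y∈ = here refl , there y∈ , λ { refl → v∉ y∈ }
builds-edge (step b xy v∉) (there (there e∈))  | _       = let u∈ , w∈ , u≢w = builds-edge b e∈ in there u∈ , there w∈ , u≢w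

module Representing (R : RealField) {n : ℕ} (G : Graph n) where
  open RealField R
  open Geometry R
  open OrderedField R
  open Lines R
  open Attaching R

  Edge : Set
  Edge = Fin n × Fin n × Ray

  ends : Edge → Fin n × Fin n
  ends (u , w , _) = u , w

  rayOf : Edge → Piece
  rayOf (_ , _ , r) = rayPiece r

  -- `separate` may be confined to recorded pairs, because in the end every edge of `G` is recorded
  -- in one of its two orders; `meet` has to cover all pairs of vertices placed so far.
  record Layout (vs : List (Fin n)) (es : List (Fin n × Fin n)) : Set where
    field
      s          : Fin n → Segment
      edges      : List Edge
      ends-edges : map ends edges ≡ es
      joins      : ∀ {u w r} → (u , w , r) ∈ edges → Joins r (s u) (s w)
      ray-seg    : ∀ {u w r z} → (u , w , r) ∈ edges → z ∈ vs → z ≢ u → z ≢ w → Crossing (rayPiece r) (segmentPiece (s z))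
      ray-ray    : AllPairs (λ ℓ ℓ′ → Crossing (rayOf ℓ) (rayOf ℓ′)) edges
      separate   : ∀ {u w} → (u , w) ∈ es → E G u w → ¬ Meets (s u) (s w)
      meet       : ∀ {u w} → u ∈ vs → w ∈ vs → u ≢ w → ¬ E G u w → Meets (s u) (s w)

    edge : ∀ {u w} → (u , w) ∈ es → ∃ λ r → (u , w , r) ∈ edges
    edge uw∈ with ∈-map⁻ ends (subst (_ ∈_) (sym ends-edges) uw∈)
    ... | (_ , _ , r) , ℓ∈ , refl = r , ℓ∈

    edge-ends : ∀ {u w r} → (u , w , r) ∈ edges → (u , w) ∈ es
    edge-ends ℓ∈ = subst (_ ∈_) ends-edges (∈-map⁺ ends ℓ∈)

  abstract
    decide : (A : Set) → ∃ λ β → ∀ {s t} → MeetsIf β s t → (A → ¬ Meets s t) × (¬ A → Meets s t)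
    decide A with weak-excluded-middle A
    ... | inj₁ ¬a  = true  , λ m → (λ a → ⊥-elim (¬a a)) , λ _ → m
    ... | inj₂ ¬¬a = false , λ ¬m → (λ _ → ¬m) , λ ¬a → ⊥-elim (¬¬a ¬a)

    unit-interval : ∃ λ ρ → 0# < ρ × ρ < 1#
    unit-interval = Small-witness (Small-map (λ ρ _ → subst (_< 1#) (*-identityˡ ρ)) (small-multiple 1# 0<1))

  -- The initial edge.

  module Initial (ρ : Carrier) (0<ρ : 0# < ρ) (ρ<1 : ρ < 1#) where

    X : Segment
    X = seg (0# , - ρ) (0# , 1# + - ρ) λ eq → 0≢1 (trans (sym (-‿inverseʳ (- ρ)))
          (trans (cong (λ p → proj₂ p + - - ρ) eq) (solve 1 (λ r → (:1 :+ :- r) :+ :- :- r := :1) refl ρ)))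

    -- The end (1, 0) is the tip for the ray. The other end has the height of the upper end of `X`:
    -- for `f = 0` these two ends coincide, for `f = 1` the segment is parallel to `X`.
    Y : Carrier → Segment
    Y f = seg (1# , 0#) (f , 1# + - ρ) λ eq → <⇒≢ (0<diff ρ<1) (cong proj₂ eq)

    axis : Ray
    axis = ray (0# , 0#) (1# , 0#) λ eq → 0≢1 (cong proj₁ eq)

    lin-X : ∀ σ → lin (0# , - ρ) (0# , 1# + - ρ) σ ≡ (0# , σ + - ρ)
    lin-X σ = cong₂ _,_ (solve 1 (λ s → :0 :+ s :* (:0 :+ :- :0) := :0) refl σ)
                        (solve 2 (λ s r → :- r :+ s :* ((:1 :+ :- r) :+ :- :- r) := s :+ :- r) refl σ ρ)

    lin-Y : ∀ f σ → lin (1# , 0#) (f , 1# + - ρ) σ ≡ (1# + σ * (f + - 1#) , σ * (1# + - ρ))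
    lin-Y f σ = cong (1# + σ * (f + - 1#) ,_) (solve 2 (λ s r → :0 :+ s :* ((:1 :+ :- r) :+ :- :0) := s :* (:1 :+ :- r)) refl σ ρ)

    lin-axis : ∀ τ → lin (0# , 0#) (1# , 0#) τ ≡ (τ , 0#)
    lin-axis τ = cong₂ _,_ (solve 1 (λ t → :0 :+ t :* (:1 :+ :- :0) := t) refl τ) (solve 1 (λ t → :0 :+ t :* (:0 :+ :- :0) := :0) refl τ)

    starts : ∀ f → Starts (rayPiece axis) (segmentPiece X) (segmentPiece (Y f))
    starts f =
      (ρ , (0<ρ , ρ<1) , hit (trans (lin-axis 0#) (trans (cong (0# ,_) (sym (-‿inverseʳ ρ))) (sym (lin-X ρ))))
        λ {τ} {σ} eq → let eq′ = trans (sym (lin-axis τ)) (trans eq (lin-X σ))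
                       in cong proj₁ eq′ , x-y≡0 (sym (cong proj₂ eq′))) ,
      (0# , inj₁ refl , hit (trans (lin-axis 1#) (trans (cong₂ _,_ (solve 1 (λ f → :1 := :1 :+ :0 :* (f :+ :- :1)) refl f) (sym (zeroˡ _))) (sym (lin-Y f 0#))))
        λ {τ} {σ} eq → let eq′ = trans (sym (lin-axis τ)) (trans eq (lin-Y f σ))
                           σ≡0 = x*y≡0 (0<x⇒x≢0 (0<diff ρ<1)) (sym (cong proj₂ eq′))
                       in trans (cong proj₁ eq′) (trans (cong (λ z → 1# + z * (f + - 1#)) σ≡0) (solve 1 (λ f → :1 :+ :0 :* (f :+ :- :1) := :1) refl f)) , σ≡0)

    choose-Y : ∀ β → ∃ λ f → MeetsIf β X (Y f)
    choose-Y true  = 0# , _ , (1# , inj₁ 0<1 , inj₂ refl , refl) , (1# , inj₁ 0<1 , inj₂ refl ,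
      trans (lin-X 1#) (trans (cong₂ _,_ (solve 0 (:0 := :1 :+ :1 :* (:0 :+ :- :1)) refl) (sym (*-identityˡ _))) (sym (lin-Y 0# 1#))))
    choose-Y false = 1# , λ { (_ , (σ , _ , _ , eq) , (σ′ , _ , _ , eq′)) →
      0≢1 (trans (cong proj₁ (trans (sym (lin-X σ)) (trans (sym eq) (trans eq′ (lin-Y 1# σ′))))) (solve 1 (λ s → :1 :+ s :* (:1 :+ :- :1) := :1) refl σ′)) }

  base-layout : ∀ {x y} → x ≢ y → Layout (x ∷ y ∷ []) ((x , y) ∷ [])
  base-layout {x} {y} x≢y = record
    { s = s ; edges = (x , y , axis) ∷ [] ; ends-edges = refl
    ; joins = λ { (here refl) → inj₁ (subst₂ (λ S T → Starts (rayPiece axis) (segmentPiece S) (segmentPiece T)) (sym sx) (sym sy) (starts f)) }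
    ; ray-seg = λ { (here refl) (here refl) z≢x _ → ⊥-elim (z≢x refl) ; (here refl) (there (here refl)) _ z≢y → ⊥-elim (z≢y refl) }
    ; ray-ray = [] ∷ []
    ; separate = λ { (here refl) → proj₁ relation }
    ; meet = λ { (here refl) (here refl) u≢u _ → ⊥-elim (u≢u refl)
               ; (here refl) (there (here refl)) _ ¬e → proj₂ relation ¬e
               ; (there (here refl)) (here refl) _ ¬e → Meets-sym (s x) (s y) (proj₂ relation λ e → ¬e (Graph.sym G e))
               ; (there (here refl)) (there (here refl)) u≢u _ → ⊥-elim (u≢u refl) }
    }
    where
    open Initial (proj₁ unit-interval) (proj₁ (proj₂ unit-interval)) (proj₂ (proj₂ unit-interval))
    decision = decide (E G x y)
    choice = choose-Y (proj₁ decision)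
    f = proj₁ choice
    s : Fin n → Segment
    s z with z ≟ y
    ... | yes _ = Y f
    ... | no _  = X
    sx : s x ≡ X
    sx with x ≟ y
    ... | yes eq = ⊥-elim (x≢y eq)
    ... | no _   = refl
    sy : s y ≡ Y f
    sy with y ≟ y
    ... | yes _  = refl
    ... | no y≢y = ⊥-elim (y≢y refl)
    relation : (E G x y → ¬ Meets (s x) (s y)) × (¬ E G x y → Meets (s x) (s y))
    relation = proj₂ decision (subst₂ (MeetsIf (proj₁ decision)) (sym sx) (sym sy) (proj₂ choice))

  step-layout : ∀ {vs es x y v} → Builds vs es → Adj es x y → v ∉ vs → Layout vs es → Layout (v ∷ vs) ((v , x) ∷ (v , y) ∷ es)
  step-layout {vs} {es} {x} {y} {v} b xy v∉ layout = record
    { s = s′ ; edges = (v , x , rX) ∷ (v , y , rY) ∷ edges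
    ; ends-edges = cong (λ es → (v , x) ∷ (v , y) ∷ es) ends-edges
    ; joins = joins′ ; ray-seg = ray-seg′
    ; ray-ray = (rX-rY ∷ All.tabulate (λ ℓ∈ → All.lookup rX-Ps (ray∈Ps ℓ∈))) ∷
                All.tabulate (λ ℓ∈ → All.lookup rY-Ps (ray∈Ps ℓ∈)) ∷ ray-ray
    ; separate = separate′ ; meet = meet′
    }
    where
    open Layout layout

    -- The edge may be recorded as `(x , y)` or as `(y , x)`; both cases are brought to the same
    -- data.
    record Common : Set where
      field
        x∈     : x ∈ vs
        y∈     : y ∈ vs
        {p q}  : Fin n
        r      : Ray
        r∈     : (p , q , r) ∈ edges
        joined : Joins r (s x) (s y)
        cross  : ∀ {z} → z ∈ vs → z ≢ x → z ≢ y → Crossing (rayPiece r) (segmentPiece (s z))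

    common : Adj es x y → Common
    common (inj₁ xy∈) = let x∈ , y∈ , _ = builds-edge b xy∈ ; r , r∈ = edge xy∈ in record
      { x∈ = x∈ ; y∈ = y∈ ; r = r ; r∈ = r∈ ; joined = joins r∈ ; cross = ray-seg r∈ }
    common (inj₂ yx∈) = let y∈ , x∈ , _ = builds-edge b yx∈ ; r , r∈ = edge yx∈ in record
      { x∈ = x∈ ; y∈ = y∈ ; r = r ; r∈ = r∈ ; joined = Sum.swap (joins r∈) ; cross = λ z∈ z≢x z≢y → ray-seg r∈ z∈ z≢y z≢x }
    open Common (common xy)

    -- The segments of `x` and `y` are left out: `r` meets them only at its start and at a tip,
    -- which is no `Crossing`, and `Extension` states their relation to the new pieces separately.
    others : List (Fin n)
    others = filter (λ z → ¬? (z ≟ x) ×-dec ¬? (z ≟ y)) vs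
    Ps : List Piece
    Ps = map (λ z → segmentPiece (s z)) others ++ map rayOf edges
    Ps-cross : All (λ P → P ≡ rayPiece r ⊎ Crossing (rayPiece r) P) Ps
    Ps-cross = Allₚ.++⁺ (Allₚ.map⁺ (All.tabulate λ z∈ → inj₂ (segments z∈))) (Allₚ.map⁺ (All.tabulate rays))
      where
      segments : ∀ {z} → z ∈ others → Crossing (rayPiece r) (segmentPiece (s z))
      segments z∈ = let z∈vs , z≢x , z≢y = ∈-filter⁻ (λ z → ¬? (z ≟ x) ×-dec ¬? (z ≟ y)) z∈
                    in cross z∈vs z≢x z≢y
      rays : ∀ {ℓ} → ℓ ∈ edges → rayOf ℓ ≡ rayPiece r ⊎ Crossing (rayPiece r) (rayOf ℓ)
      rays ℓ∈ with allPairs-lookup Crossing-sym ray-ray r∈ ℓ∈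
      ... | inj₁ same    = inj₁ (sym (cong rayOf same))
      ... | inj₂ crosses = inj₂ crosses

    decision-x = decide (E G v x)
    decision-y = decide (E G v y)
    open Extension (extend-joined (s x) (s y) r (proj₁ decision-x) (proj₁ decision-y) Ps joined Ps-cross)

    seg∈Ps : ∀ {z} → z ∈ vs → z ≢ x → z ≢ y → segmentPiece (s z) ∈ Ps
    seg∈Ps z∈ z≢x z≢y = ∈-++⁺ˡ (∈-map⁺ _ (∈-filter⁺ _ z∈ (z≢x , z≢y)))
    ray∈Ps : ∀ {ℓ} → ℓ ∈ edges → rayOf ℓ ∈ Ps
    ray∈Ps ℓ∈ = ∈-++⁺ʳ _ (∈-map⁺ rayOf ℓ∈)

    s′ : Fin n → Segment
    s′ z with z ≟ v
    ... | yes _ = V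
    ... | no _  = s z
    new : s′ v ≡ V
    new with v ≟ v
    ... | yes _  = refl
    ... | no v≢v = ⊥-elim (v≢v refl)
    old : ∀ {z} → z ∈ vs → s′ z ≡ s z
    old {z} z∈ with z ≟ v
    ... | yes refl = ⊥-elim (v∉ z∈)
    ... | no _     = refl

    joins′ : ∀ {u w r} → (u , w , r) ∈ (v , x , rX) ∷ (v , y , rY) ∷ edges → Joins r (s′ u) (s′ w)
    joins′ (here refl)         = subst₂ (Joins rX) (sym new) (sym (old x∈)) joinsX
    joins′ (there (here refl)) = subst₂ (Joins rY) (sym new) (sym (old y∈)) joinsY
    joins′ {r = r} (there (there ℓ∈)) = let u∈ , w∈ , _ = builds-edge b (edge-ends ℓ∈) in subst₂ (Joins r) (sym (old u∈)) (sym (old w∈)) (joins ℓ∈)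

    onto : ∀ {P z} → z ∈ vs → Crossing P (segmentPiece (s z)) → Crossing P (segmentPiece (s′ z))
    onto {P} z∈ = subst (λ S → Crossing P (segmentPiece S)) (sym (old z∈))

    ray-seg′ : ∀ {u w r z} → (u , w , r) ∈ (v , x , rX) ∷ (v , y , rY) ∷ edges → z ∈ v ∷ vs → z ≢ u → z ≢ w →
      Crossing (rayPiece r) (segmentPiece (s′ z))
    ray-seg′ (here refl)         (here refl) z≢u _ = ⊥-elim (z≢u refl)
    ray-seg′ (there (here refl)) (here refl) z≢u _ = ⊥-elim (z≢u refl)
    ray-seg′ {r = r} (there (there ℓ∈)) (here refl) _ _ = subst (λ S → Crossing (rayPiece r) (segmentPiece S)) (sym new)
      (Crossing-sym {segmentPiece V} {rayPiece r} (All.lookup V-Ps (ray∈Ps ℓ∈)))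
    ray-seg′ {z = z} (here refl) (there z∈) _ z≢x with z ≟ y
    ... | yes refl = onto {rayPiece rX} z∈ rX-Y
    ... | no z≢y   = onto {rayPiece rX} z∈ (All.lookup rX-Ps (seg∈Ps z∈ z≢x z≢y))
    ray-seg′ {z = z} (there (here refl)) (there z∈) _ z≢y with z ≟ x
    ... | yes refl = onto {rayPiece rY} z∈ rY-X
    ... | no z≢x   = onto {rayPiece rY} z∈ (All.lookup rY-Ps (seg∈Ps z∈ z≢x z≢y))
    ray-seg′ {r = r} (there (there ℓ∈)) (there z∈) z≢u z≢w = onto {rayPiece r} z∈ (ray-seg ℓ∈ z∈ z≢u z≢w)

    separate′ : ∀ {u w} → (u , w) ∈ (v , x) ∷ (v , y) ∷ es → E G u w → ¬ Meets (s′ u) (s′ w)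
    separate′ (here refl)         e = subst₂ (λ S T → ¬ Meets S T) (sym new) (sym (old x∈)) (proj₁ (proj₂ decision-x V-X) e)
    separate′ (there (here refl)) e = subst₂ (λ S T → ¬ Meets S T) (sym new) (sym (old y∈)) (proj₁ (proj₂ decision-y V-Y) e)
    separate′ (there (there uw∈)) e = let u∈ , w∈ , _ = builds-edge b uw∈ in
      subst₂ (λ S T → ¬ Meets S T) (sym (old u∈)) (sym (old w∈)) (separate uw∈ e)

    meet-new : ∀ {w} → w ∈ vs → ¬ E G v w → Meets V (s w)
    meet-new {w} w∈ ¬e with w ≟ x | w ≟ y
    ... | yes refl | _        = proj₂ (proj₂ decision-x V-X) ¬e
    ... | no _     | yes refl = proj₂ (proj₂ decision-y V-Y) ¬e
    ... | no w≢x   | no w≢y   = crossing⇒meets V (s w) (All.lookup V-Ps (seg∈Ps w∈ w≢x w≢y))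

    meet′ : ∀ {u w} → u ∈ v ∷ vs → w ∈ v ∷ vs → u ≢ w → ¬ E G u w → Meets (s′ u) (s′ w)
    meet′ (here refl) (here refl) u≢w _  = ⊥-elim (u≢w refl)
    meet′ (here refl) (there w∈)  _   ¬e = subst₂ Meets (sym new) (sym (old w∈)) (meet-new w∈ ¬e)
    meet′ {u} (there u∈) (here refl) _ ¬e = subst₂ Meets (sym (old u∈)) (sym new) (Meets-sym V (s u) (meet-new u∈ λ e → ¬e (Graph.sym G e)))
    meet′ (there u∈)  (there w∈)  u≢w ¬e = subst₂ Meets (sym (old u∈)) (sym (old w∈)) (meet u∈ w∈ u≢w ¬e)

  layout : ∀ {vs es} → Builds vs es → Layout vs es
  layout (base x≢y)     = base-layout x≢y
  layout (step b xy v∉) = step-layout b xy v∉ (layout b)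

  -- From the layout to the representation.

  SamePair : Fin n × Fin n → Fin n × Fin n → Set
  SamePair (p , q) (u , w) = (p ≡ u × q ≡ w) ⊎ (p ≡ w × q ≡ u)

  samePair? : ∀ u w ℓ → Dec (SamePair (ends ℓ) (u , w))
  samePair? u w (p , q , _) = (p ≟ u ×-dec q ≟ w) ⊎-dec (p ≟ w ×-dec q ≟ u)

  representation : ∀ {GT : Graph n} → IsTwoTree GT → SpanningSubgraph G GT →
    Σ (Fin n → Segment) λ s → SegmentRep (complement G) s × Compatible GT s
  representation {GT} (vs , es , b , all∈ , E⇔Adj) G⊆GT = s , segmentRep , ray-between , compatible
    where
    open Layout (layout b)

    separate-adjacent : ∀ {u w} → Adj es u w → E G u w → ¬ Meets (s u) (s w)
    separate-adjacent         (inj₁ uw∈) e m = separate uw∈ e m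
    separate-adjacent {u} {w} (inj₂ wu∈) e m = separate wu∈ (Graph.sym G e) (Meets-sym (s u) (s w) m)

    segmentRep : SegmentRep (complement G) s
    segmentRep u w u≢w =
      -- An edge of `G` is an edge of the 2-tree, hence recorded in one of its orders and separated.
      (λ m → u≢w , λ e → separate-adjacent (proj₁ (E⇔Adj u w) (G⊆GT u w e)) e m) ,
      (λ { (_ , ¬e) → meet (all∈ u) (all∈ w) u≢w ¬e })

    ray-between : Fin n → Fin n → Ray
    ray-between u w with any? (samePair? u w) edges
    ... | yes found = proj₂ (proj₂ (proj₁ (find found)))
    -- A dummy value for pairs without a recorded ray; `ray-edge` shows that it never occurs on an
    -- edge.
    ... | no _      = ray (0# , 0#) (1# , 0#) λ eq → 0≢1 (cong proj₁ eq)

    ray-edge : ∀ u w → E GT u w → ∃ λ p → ∃ λ q → (p , q , ray-between u w) ∈ edges × SamePair (p , q) (u , w)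
    ray-edge u w e with any? (samePair? u w) edges
    ... | yes found = let (p , q , _) , ℓ∈ , match = find found in p , q , ℓ∈ , match
    ... | no none with proj₁ (E⇔Adj u w) e
    ...   | inj₁ uw∈ = ⊥-elim (none (lose (proj₂ (edge uw∈)) (inj₁ (refl , refl))))
    ...   | inj₂ wu∈ = ⊥-elim (none (lose (proj₂ (edge wu∈)) (inj₂ (refl , refl))))

    joins⇒StartsIn : ∀ r S T → Joins r S T → StartsIn r S T ⊎ StartsIn r T S
    joins⇒StartsIn r S T = Sum.map (starts⇒StartsIn r S T) (starts⇒StartsIn r T S)

    compatible : ∀ u w → E GT u w →
      (StartsIn (ray-between u w) (s u) (s w) ⊎ StartsIn (ray-between u w) (s w) (s u)) ×
      (∀ z → z ≢ u → z ≢ w → CrossRS (ray-between u w) (s z)) ×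
      (∀ x y → E GT x y → ¬ (x ≡ u × y ≡ w) → ¬ (x ≡ w × y ≡ u) → CrossRR (ray-between u w) (ray-between x y))
    compatible u w e with ray-edge u w e
    ... | p , q , ℓ∈ , match = starts match , crosses match , crosses-ray
      where
      starts : SamePair (p , q) (u , w) → StartsIn (ray-between u w) (s u) (s w) ⊎ StartsIn (ray-between u w) (s w) (s u)
      starts (inj₁ (refl , refl)) = joins⇒StartsIn (ray-between u w) (s u) (s w) (joins ℓ∈)
      starts (inj₂ (refl , refl)) = Sum.swap (joins⇒StartsIn (ray-between u w) (s w) (s u) (joins ℓ∈))
      crosses : SamePair (p , q) (u , w) → ∀ z → z ≢ u → z ≢ w → CrossRS (ray-between u w) (s z)
      crosses (inj₁ (refl , refl)) z z≢u z≢w = crossing⇒CrossRS (ray-between u w) (s z) (ray-seg ℓ∈ (all∈ z) z≢u z≢w)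
      crosses (inj₂ (refl , refl)) z z≢u z≢w = crossing⇒CrossRS (ray-between u w) (s z) (ray-seg ℓ∈ (all∈ z) z≢w z≢u)
      crosses-ray : ∀ x y → E GT x y → ¬ (x ≡ u × y ≡ w) → ¬ (x ≡ w × y ≡ u) → CrossRR (ray-between u w) (ray-between x y)
      crosses-ray x y e′ ≢₁ ≢₂ with ray-edge x y e′
      -- Two entries cross or are equal. Equal entries have the same ends, which would make `x` and
      -- `y` the ends `u` and `w` in one of the two orders.
      ... | p′ , q′ , ℓ′∈ , match′ with allPairs-lookup Crossing-sym ray-ray ℓ∈ ℓ′∈
      ...   | inj₂ cross = crossing⇒CrossRR (ray-between u w) (ray-between x y) cross
      ...   | inj₁ eq    = ⊥-elim (same (cong ends eq) match match′)
        where
        same : (p , q) ≡ (p′ , q′) → SamePair (p , q) (u , w) → SamePair (p′ , q′) (x , y) → ⊥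
        same refl (inj₁ (refl , refl)) (inj₁ (refl , refl)) = ≢₁ (refl , refl)
        same refl (inj₁ (refl , refl)) (inj₂ (refl , refl)) = ≢₂ (refl , refl)
        same refl (inj₂ (refl , refl)) (inj₁ (refl , refl)) = ≢₂ (refl , refl)
        same refl (inj₂ (refl , refl)) (inj₂ (refl , refl)) = ≢₁ (refl , refl)

theorem1 : (R : RealField) → (n : ℕ) → (G GT : Graph n) →
    IsTwoTree GT → SpanningSubgraph G GT →
    Σ (Fin n → Geometry.Segment R) λ s →
    Geometry.SegmentRep R (complement G) s × Geometry.Compatible R GT s
theorem1 R n G GT isTwoTree G⊆GT = Representing.representation R G {GT} isTwoTree G⊆GT
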